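{- Let $H=(V,E)$ be a connected hypergraph with $|V|\ge2$. Then $H$ is homogeneous (i.e. the optimal density $\tilde\eta^*$ of $\operatorname{Mod}_2(\widehat\Omega(H))$ is a constant vector, where $\Omega(H)$ is the multi-tree family of $H$) if and only if its strength coincides with its fractional arboricity, i.e. $S(H)=D(H)$.
   Context: A hypergraph $H=(V,E)$ has a finite nonempty vertex set $V$ and a finite collection $E$ of subsets of $V$ (hyperedges), where repetitions are allowed (parallel hyperedges are distinct elements of $E$) and every hyperedge has at least two vertices. $H$ is connected if for every nonempty proper subset $X\subset V$ some hyperedge intersects both $X$ and $V\setminus X$. For $X\subseteq V$, $E[X]$ is the set of hyperedges contained in $X$. For a partition $\mathscr P$ of $V$ into nonempty parts, $|\mathscr P|$ is the number of parts and $\delta(\mathscr P)$ is the set of hyperedges intersecting at least two parts. Strength: $S(H)=\min\left\{\frac{|\delta(\mathscr P)|}{|\mathscr P|-1}:\mathscr P\text{ a partition of }V,\ |\mathscr P|\ge2\right\}$. Fractional arboricity: $D(H)=\max\left\{\frac{|E[X]|}{|X|-1}:X\subseteq V,\ |X|\ge2\right\}$. A set (or multiset) $F$ of hyperedges is a hyperforest if for every nonempty $X\subseteq V$ at most $|X|-1$ members of $F$ (counted with multiplicity) are contained in $X$; a hypertree is a hyperforest with $|F|=|V|-1$. For a multiset $A$ from $E$, $H[A]$ is the hypergraph with vertex set $\bigcup_{e\in A}e$ and hyperedges the members of $A$ (copies being parallel hyperedges), and $x^A\in\mathbb{R}^E_{\ge0}$ has $x^A(e)$ equal to the multiplicity of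 $e$ in $A$. The multi-tree family $\Omega(H)$ is the set of all $x^A$ such that $H[A]$ is a hypertree with vertex set $V$. For a family $\Gamma\subset\mathbb{R}^E_{\ge0}$, $\operatorname{Adm}(\Gamma)=\{\rho\in\mathbb{R}^E_{\ge0}:\gamma^T\rho\ge1\ \forall\gamma\in\Gamma\}$; the Fulkerson blocker family $\widehat\Gamma$ is the set of extreme points of $\operatorname{Adm}(\Gamma)$; $\operatorname{Mod}_2(\Gamma)=\inf_{\rho\in\operatorname{Adm}(\Gamma)}\sum_{e\in E}\rho(e)^2$, and its optimal density is the unique minimizer. -}

module Defs where

open import Level using (Level; _⊔_) renaming (suc to lsuc)
open import Algebra.Apartness.Bundles using (HeytingCommutativeRing; HeytingField)
open import Algebra.Bundles using (CommutativeRing)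
import Algebra.Definitions.RawMonoid as RawMonoidDefs
open import Data.Bool.Base using (if_then_else_)
open import Data.Fin.Base using (Fin)
open import Data.Fin.Properties using (any?) renaming (_≟_ to _≟ᶠ_)
open import Data.Fin.Subset using (Subset; _∈_; _⊆_; _⊂_; _∩_; ∁; ⊤; ∣_∣; Nonempty)
open import Data.Fin.Subset.Properties using (_⊆?_; nonempty?)
import Data.Integer.Base as ℤ
open import Data.Nat.Base as ℕ using (ℕ; suc; s≤s; NonZero; +-0-rawMonoid)
import Data.Rational.Base as ℚ
open ℚ using (ℚ)
open import Data.Product.Base using (∃-syntax; _×_)
open import Data.Sum.Base using (_⊎_)
open import Data.Vec.Base using (tabulate)
open import Data.Vec.Functional using (Vector)
open import Relation.Binary.Core using (Rel)
open import Relation.Binary.PropositionalEquality.Core using (_≡_; _≢_)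
open import Relation.Binary.Structures using (IsStrictPartialOrder)
open import Relation.Nullary.Decidable.Core using (Dec; does; ¬?; _×-dec_)
open import Relation.Nullary.Negation.Core using (¬_)
open import Relation.Unary using (Pred)

------------------------------------------------------------------------
-- The real numbers

-- The standard library has no type of real numbers, so ℝ is characterised
-- axiomatically, as a Cauchy-complete Archimedean ordered field.  The axioms
-- are stated constructively (the order is not assumed decidable, x ≤ y means
-- ¬ (y < x), and only elements apart from 0 are invertible), so they hold
-- for the Bishop reals.  With excluded middle they determine ℝ up to unique
-- isomorphism.  The laws 0 < 1 and cotransitivity of _<_ follow from the
-- Heyting field axioms and #⇒≶, ≶⇒#.

record RealNumbers (c ℓ₁ ℓ₂ : Level) : Set (lsuc (c ⊔ ℓ₁ ⊔ ℓ₂)) where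
  infix 4 _<_ _≤_
  field
    heytingField : HeytingField c ℓ₁ ℓ₂

  open HeytingField heytingField public
  open HeytingCommutativeRing heytingCommutativeRing public using (commutativeRing)

  open RawMonoidDefs (CommutativeRing.+-rawMonoid commutativeRing) public
    using (sum) renaming (_×_ to _·_)

  field
    _<_                  : Rel Carrier ℓ₂
    isStrictPartialOrder : IsStrictPartialOrder _≈_ _<_
    #⇒≶                  : ∀ {x y} → x # y → x < y ⊎ y < x
    ≶⇒#                  : ∀ {x y} → x < y ⊎ y < x → x # y
    +-monoˡ-<            : ∀ {x y} z → x < y → x + z < y + z
    *-pos                : ∀ {x y} → 0# < x → 0# < y → 0# < x * y
    archimedean          : ∀ x → ∃[ n ] x < n · 1#

  _≤_ : Rel Carrier ℓ₂
  x ≤ y = ¬ (y < x)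

  fromℕ : ℕ → Carrier
  fromℕ n = n · 1#

  -- ∣ x - y ∣ < 1 / (k + 1), written without division.
  Within : ℕ → Rel Carrier ℓ₂
  Within k x y = suc k · (x - y) < 1# × suc k · (y - x) < 1#

  IsCauchy : (ℕ → Carrier) → Set ℓ₂
  IsCauchy s =
    ∀ k → ∃[ N ] (∀ i j → N ℕ.≤ i → N ℕ.≤ j → Within k (s i) (s j))

  ConvergesTo : (ℕ → Carrier) → Carrier → Set ℓ₂
  ConvergesTo s l = ∀ k → ∃[ N ] (∀ i → N ℕ.≤ i → Within k (s i) l)

  field
    complete : ∀ s → IsCauchy s → ∃[ l ] ConvergesTo s l

------------------------------------------------------------------------
-- Hypergraphs

-- V = Fin ∣V∣.  Hyperedges are indexed by Fin ∣E∣, so parallel hyperedges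
-- (equal subsets at different indices) are distinct.

record Hypergraph : Set where
  field
    ∣V∣         : ℕ
    ∣E∣         : ℕ
    V-nonempty  : NonZero ∣V∣
    edge        : Fin ∣E∣ → Subset ∣V∣
    edge-size≥2 : ∀ e → 2 ℕ.≤ ∣ edge e ∣

record Partition (n : ℕ) : Set where
  field
    #parts   : ℕ
    part     : Fin #parts → Subset n
    nonempty : ∀ i → Nonempty (part i)
    disjoint : ∀ i j v → v ∈ part i → v ∈ part j → i ≡ j
    cover    : ∀ v → ∃[ i ] v ∈ part i

-- a / (k - 1)
ratio : ∀ a k → 2 ℕ.≤ k → ℚ
ratio a (suc (suc k)) (s≤s (s≤s _)) = ℤ.+ a ℚ./ suc k

IsMinimum IsMaximum : ∀ {ℓ} → Pred ℚ ℓ → Pred ℚ ℓ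
IsMinimum P r = P r × (∀ q → P q → r ℚ.≤ q)
IsMaximum P r = P r × (∀ q → P q → q ℚ.≤ r)

module _ (H : Hypergraph) where
  open Hypergraph H
  open Partition

  Connected : Set
  Connected = ∀ (X : Subset ∣V∣) → Nonempty X → X ⊂ ⊤ →
    ∃[ e ] Nonempty (edge e ∩ X) × Nonempty (edge e ∩ ∁ X)

  E[_] : Subset ∣V∣ → Subset ∣E∣
  E[ X ] = tabulate λ e → does (edge e ⊆? X)

  Crosses : Partition ∣V∣ → Fin ∣E∣ → Set
  Crosses P e = ∃[ i ] ∃[ j ] i ≢ j
    × Nonempty (edge e ∩ part P i) × Nonempty (edge e ∩ part P j)

  crosses? : ∀ P e → Dec (Crosses P e)
  crosses? P e = any? λ i → any? λ j → ¬? (i ≟ᶠ j)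
    ×-dec nonempty? (edge e ∩ part P i) ×-dec nonempty? (edge e ∩ part P j)

  δ : Partition ∣V∣ → Subset ∣E∣
  δ P = tabulate λ e → does (crosses? P e)

  IsStrength : Pred ℚ _
  IsStrength = IsMinimum λ q →
    ∃[ P ] ∃[ 2≤∣P∣ ] q ≡ ratio ∣ δ P ∣ (#parts P) 2≤∣P∣

  IsFractionalArboricity : Pred ℚ _
  IsFractionalArboricity = IsMaximum λ q →
    ∃[ X ] ∃[ 2≤∣X∣ ] q ≡ ratio ∣ E[ X ] ∣ ∣ X ∣ 2≤∣X∣

  -- A multiset of hyperedges is given by its multiplicities.

  Multiset : Set
  Multiset = Fin ∣E∣ → ℕ

  open RawMonoidDefs +-0-rawMonoid using () renaming (sum to sumℕ)

  size : Multiset → ℕ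
  size A = sumℕ A

  sizeIn : Multiset → Subset ∣V∣ → ℕ
  sizeIn A X = sumℕ λ e → if does (edge e ⊆? X) then A e else 0

  IsHyperforest : Multiset → Set
  IsHyperforest A = ∀ X → Nonempty X → sizeIn A X ℕ.≤ ∣ X ∣ ℕ.∸ 1

  -- H[A] is a hypertree with vertex set V.
  record IsSpanningHypertree (A : Multiset) : Set where
    field
      spanning    : ∀ v → ∃[ e ] 0 ℕ.< A e × v ∈ edge e
      hyperforest : IsHyperforest A
      size≡∣V∣-1  : size A ≡ ∣V∣ ℕ.∸ 1

------------------------------------------------------------------------
-- Modulus

module Modulus {c ℓ₁ ℓ₂} (ℝ : RealNumbers c ℓ₁ ℓ₂) where
  open RealNumbers ℝ

  Adm : ∀ {m ℓ} → Pred (Vector Carrier m) ℓ → Pred (Vector Carrier m) _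
  Adm Γ ρ = (∀ e → 0# ≤ ρ e) × (∀ γ → Γ γ → 1# ≤ sum λ e → γ e * ρ e)

  IsExtremePoint : ∀ {m ℓ} → Pred (Vector Carrier m) ℓ → Pred (Vector Carrier m) _
  IsExtremePoint C ρ = C ρ × (∀ x y t → C x → C y → 0# < t → t < 1# →
    (∀ e → ρ e ≈ t * x e + (1# - t) * y e) → ∀ e → x e ≈ y e)

  Blocker : ∀ {m ℓ} → Pred (Vector Carrier m) ℓ → Pred (Vector Carrier m) _
  Blocker Γ = IsExtremePoint (Adm Γ)

  energy₂ : ∀ {m} → Vector Carrier m → Carrier
  energy₂ ρ = sum λ e → ρ e * ρ e

  -- ρ attains the infimum Mod₂ Γ.
  IsOptimalDensity : ∀ {m ℓ} → Pred (Vector Carrier m) ℓ → Pred (Vector Carrier m) _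
  IsOptimalDensity Γ ρ = Adm Γ ρ × (∀ σ → Adm Γ σ → energy₂ ρ ≤ energy₂ σ)

  IsConstant : ∀ {m} → Pred (Vector Carrier m) _
  IsConstant ρ = ∃[ a ] ∀ e → ρ e ≈ a

  module _ (H : Hypergraph) where
    open Hypergraph H

    Ω : Pred (Vector Carrier ∣E∣) _
    Ω γ = ∃[ A ] IsSpanningHypertree H A × (∀ e → γ e ≈ fromℕ (A e))

    -- The optimal density is unique by strict convexity of energy₂, so an
    -- existential quantifier suffices.
    Homogeneous : Set _
    Homogeneous = ∃[ η ] IsOptimalDensity (Blocker Ω) η × IsConstant η

{-# OPTIONS --safe #-}
module Submission where

-- Write m = ∣E∣ and N = ∣V∣ - 1.  Both sides are equivalent to the constant
-- vector N / m satisfying the hyperforest inequalities, that is, to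
-- N ∣E[X]∣ ≤ m (∣X∣ - 1) for all nonempty X.  For S(H) = D(H) this is a count
-- over the parts of a partition.  For homogeneity, the key is that a
-- nonnegative linear functional is minimised over Adm Ω at an extreme point, so
-- a density admissible for the blocker pairs to at least 1 with all of Adm Ω.
-- Pairing a constant optimal density a with the density of the partition
-- {X} ∪ singletons bounds a from below; since moving it towards a hypertree
-- does not decrease the energy, a m ≤ N.  Conversely, by Kruskal's greedy
-- algorithm every ρ in Adm Ω satisfies m ≤ N ∑ρ, so N / m is admissible for the
-- blocker; every such density has total mass at least N, so by Cauchy-Schwarz
-- N / m is optimal.
--
-- The order of ℝ is not decidable, but x ≤ y is a negated statement, so
-- classical case distinctions are available in proofs of inequalities.

open import Defs
open import Level using (_⊔_)
open import Algebra.Bundles using (CommutativeRing; RawRing)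
import Algebra.Apartness.Properties.HeytingCommutativeRing as HeytingProperties
import Algebra.Properties.Ring as RingProperties
import Algebra.Properties.Semiring.Mult as SemiringMult
import Algebra.Properties.Semiring.Sum as SemiringSum
import Algebra.Solver.Ring as RingSolver
open import Algebra.Solver.Ring.AlmostCommutativeRing
  using (fromCommutativeRing; _-Raw-AlmostCommutative⟶_)
open import Data.Bool.Base using (true; false; if_then_else_)
import Data.Bool.Properties as Bool
open import Data.Empty using (⊥)
open import Data.Fin.Base
  using (Fin; zero; suc; toℕ; fromℕ<; splitAt; join; _↑ˡ_; finToFun; funToFin)
import Data.Fin.Properties as Fin
open import Data.Fin.Subset
  using (Subset; _∈_; _∉_; _⊆_; _⊃_; _∪_; ∁; ⁅_⁆; ∣_∣; ⊤; Nonempty)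
open import Data.Fin.Subset.Induction using (⊃-wellFounded; Acc; acc)
import Data.Fin.Subset.Properties as Subset
open Subset using (_∈?_; _⊆?_)
import Data.Integer.Base as ℤ
import Data.Integer.Properties as ℤ
open import Data.List.Base using (List; []; _∷_; allFin)
open import Data.List.Membership.Propositional using () renaming (_∈_ to _∈ᴸ_)
open import Data.List.Membership.Propositional.Properties using (∈-allFin)
open import Data.List.Relation.Unary.Any using (here; there)
open import Data.Maybe.Base using (Maybe; just; nothing)
open import Data.Nat.Base as ℕ using (ℕ; zero; suc; z≤n; s≤s)
import Data.Nat.Properties as ℕ
import Algebra.Properties.Semiring.Sum ℕ.+-*-semiring as ℕ∑
open import Data.Nat.Tactic.RingSolver using (solve-∀)
open import Data.Product.Base using (∃-syntax; ∃; _×_; _,_; proj₁; proj₂)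
import Data.Rational.Base as ℚ
import Data.Rational.Properties as ℚ
import Data.Rational.Unnormalised.Base as ℚᵘ
import Data.Rational.Unnormalised.Properties as ℚᵘ
open import Data.Sum.Base using (_⊎_; inj₁; inj₂; [_,_]′)
open import Data.Vec.Base using (tabulate; []; _∷_)
open import Data.Vec.Functional using (Vector)
import Data.Vec.Properties as Vec
open import Function.Base using (_∘_; case_of_)
open import Function.Bundles using (_⇔_; mk⇔)
import Relation.Binary.Reasoning.Base.Triple as TripleReasoning
open import Relation.Binary.PropositionalEquality as ≡ using (_≡_; _≢_)
open import Relation.Binary.Structures using (IsPreorder; IsStrictPartialOrder)
open import Relation.Nullary.Decidable
  using (Dec; yes; no; does; dec-true; dec-false; _×-dec_; ¬?; ¬¬-excluded-middle; decidable-stable)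
open import Relation.Nullary.Negation using (¬_; contradiction)
open import Relation.Unary using (Pred)

-- Whether `H` has a spanning hypertree at all is not known in advance. In one direction its
-- existence follows from admissibility for the blocker: if Ω were empty, the zero density would lie
-- in `Adm` of Ω and pair to 0 with everything. In the other direction Kruskal's algorithm builds
-- one. Its success rests on multiplicities: a hyperedge may be taken repeatedly until all its
-- vertices are joined, so a processed hyperedge always lies inside one component, and the
-- inequalities of `Balanced` can be summed over the components. Each copy is witnessed by two of
-- its vertices in different components, so the forest is tracked as a graph forest would be, by a
-- labelling of the vertices.
--
-- The value N / m is forced by two extreme choices: the partition into singletons and the set X =
-- V. The bound N on the total mass of a blocker-admissible density comes from the constant density
-- 1 / N, which pairs to exactly 1 with every hypertree.
--
-- `¬¬-∀Fin` makes finitely many classical choices at once inside the proof of a negation.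

¬¬-∀Fin : ∀ {n p} {P : Fin n → Set p} → (∀ i → ¬ ¬ P i) → ¬ ¬ (∀ i → P i)
¬¬-∀Fin {zero}  h k = k λ ()
¬¬-∀Fin {suc n} h k = h zero λ p₀ → ¬¬-∀Fin (h ∘ suc) λ p →
  k λ { zero → p₀ ; (suc i) → p i }

-- Ordered-field arithmetic, with a ring solver over the reals.

module RealProperties {c ℓ₁ ℓ₂} (ℝ : RealNumbers c ℓ₁ ℓ₂) where
  open RealNumbers ℝ hiding (zero)
  open CommutativeRing commutativeRing public
    using (ring; semiring)
  open IsStrictPartialOrder isStrictPartialOrder public using (<-resp-≈; <-respʳ-≈; <-respˡ-≈)
    renaming (irrefl to <-irrefl; trans to <-trans; asym to <-asym)
  open RingProperties ring
    using (-‿distribˡ-*; -‿distribʳ-*; -‿involutive; -‿+-comm)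
  open SemiringMult semiring using (×-homo-+; ×1-homo-*; ×-congˡ)
  open SemiringSum semiring public
    using (sum-cong-≋; ∑-distrib-+; *-distribˡ-sum)
  open HeytingProperties heytingCommutativeRing using (1#0; x-0≈x)

  private
    -- (a , b) stands for the integer a - b.
    Coeff : RawRing _ _
    Coeff = record
      { Carrier = ℕ × ℕ
      ; _≈_     = _≡_
      ; _+_     = λ (a , b) (a′ , b′) → a ℕ.+ a′ , b ℕ.+ b′
      ; _*_     = λ (a , b) (a′ , b′) → a ℕ.* a′ ℕ.+ b ℕ.* b′ , a ℕ.* b′ ℕ.+ b ℕ.* a′
      ; -_      = λ (a , b) → b , a
      ; 0#      = 0 , 0
      ; 1#      = 1 , 0
      }

    x-y+z-w : ∀ x y z w → (x + z) - (y + w) ≈ (x - y) + (z - w)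
    x-y+z-w x y z w = begin
      (x + z) - (y + w)       ≈⟨ +-congˡ (-‿+-comm y w) ⟨
      (x + z) + (- y + - w)   ≈⟨ +-assoc x z _ ⟩
      x + (z + (- y + - w))   ≈⟨ +-congˡ (+-assoc z (- y) (- w)) ⟨
      x + ((z + - y) + - w)   ≈⟨ +-congˡ (+-congʳ (+-comm z (- y))) ⟩
      x + ((- y + z) + - w)   ≈⟨ +-congˡ (+-assoc (- y) z (- w)) ⟩
      x + (- y + (z - w))     ≈⟨ +-assoc x (- y) _ ⟨
      (x - y) + (z - w)       ∎
      where open import Relation.Binary.Reasoning.Setoid setoid

    [x-y]*[z-w] : ∀ x y z w → (x * z + y * w) - (x * w + y * z) ≈ (x - y) * (z - w)
    [x-y]*[z-w] x y z w = begin
      (x * z + y * w) - (x * w + y * z)           ≈⟨ x-y+z-w _ _ _ _ ⟩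
      (x * z - x * w) + (y * w - y * z)           ≈⟨ +-cong (+-congˡ (-‿distribʳ-* x w))
                                                        (+-cong (sym (-‿involutive _)) (-‿distribˡ-* y z)) ⟩
      (x * z + x * - w) + (- - (y * w) + - y * z) ≈⟨ +-cong (sym (distribˡ x z (- w)))
                                                        (+-comm _ _) ⟩
      x * (z - w) + (- y * z + - - (y * w))       ≈⟨ +-congˡ (+-congˡ (-‿cong (-‿distribˡ-* y w))) ⟩
      x * (z - w) + (- y * z + - (- y * w))       ≈⟨ +-congˡ (+-congˡ (-‿distribʳ-* (- y) w)) ⟩
      x * (z - w) + (- y * z + - y * - w)         ≈⟨ +-congˡ (distribˡ (- y) z (- w)) ⟨
      x * (z - w) + - y * (z - w)                 ≈⟨ distribʳ (z - w) x (- y) ⟨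
      (x - y) * (z - w)                           ∎
      where open import Relation.Binary.Reasoning.Setoid setoid

    -- The values at 0 and 1 are split off so that the solver's constants reduce to `0#` and `1#`
    -- themselves rather than to a difference of numerals.
    ⟦_⟧ : ℕ × ℕ → Carrier
    ⟦ 0 , 0 ⟧ = 0#
    ⟦ 1 , 0 ⟧ = 1#
    ⟦ a , b ⟧ = fromℕ a - fromℕ b

    ⟦⟧≈ : ∀ a b → ⟦ a , b ⟧ ≈ fromℕ a - fromℕ b
    ⟦⟧≈ 0             0       = sym (-‿inverseʳ 0#)
    ⟦⟧≈ 0             (suc b) = refl
    ⟦⟧≈ 1             0       = sym (trans (+-congʳ (+-identityʳ 1#)) (x-0≈x 1#))
    ⟦⟧≈ 1             (suc b) = refl
    ⟦⟧≈ (suc (suc a)) 0       = refl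
    ⟦⟧≈ (suc (suc a)) (suc b) = refl

    homomorphism : Coeff -Raw-AlmostCommutative⟶ fromCommutativeRing commutativeRing
    homomorphism = record
      { ⟦_⟧    = ⟦_⟧
      ; +-homo = λ (a , b) (c , d) → begin
          ⟦ a ℕ.+ c , b ℕ.+ d ⟧                          ≈⟨ ⟦⟧≈ (a ℕ.+ c) (b ℕ.+ d) ⟩
          fromℕ (a ℕ.+ c) - fromℕ (b ℕ.+ d)
            ≈⟨ +-cong (×-homo-+ 1# a c) (-‿cong (×-homo-+ 1# b d)) ⟩
          (fromℕ a + fromℕ c) - (fromℕ b + fromℕ d)      ≈⟨ x-y+z-w _ _ _ _ ⟩
          (fromℕ a - fromℕ b) + (fromℕ c - fromℕ d)      ≈⟨ +-cong (⟦⟧≈ a b) (⟦⟧≈ c d) ⟨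
          ⟦ a , b ⟧ + ⟦ c , d ⟧                          ∎
      ; *-homo = λ (a , b) (c , d) → begin
          ⟦ a ℕ.* c ℕ.+ b ℕ.* d , a ℕ.* d ℕ.+ b ℕ.* c ⟧  ≈⟨ ⟦⟧≈ (a ℕ.* c ℕ.+ b ℕ.* d) (a ℕ.* d ℕ.+ b ℕ.* c) ⟩
          fromℕ (a ℕ.* c ℕ.+ b ℕ.* d) - fromℕ (a ℕ.* d ℕ.+ b ℕ.* c)
            ≈⟨ +-cong (*+*-homo a c b d) (-‿cong (*+*-homo a d b c)) ⟩
          _                                              ≈⟨ [x-y]*[z-w] _ _ _ _ ⟩
          (fromℕ a - fromℕ b) * (fromℕ c - fromℕ d)      ≈⟨ *-cong (⟦⟧≈ a b) (⟦⟧≈ c d) ⟨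
          ⟦ a , b ⟧ * ⟦ c , d ⟧                          ∎
      ; -‿homo = λ (a , b) → begin
          ⟦ b , a ⟧                ≈⟨ ⟦⟧≈ b a ⟩
          fromℕ b - fromℕ a        ≈⟨ +-comm _ _ ⟩
          - fromℕ a + fromℕ b      ≈⟨ +-congˡ (-‿involutive _) ⟨
          - fromℕ a + - - fromℕ b  ≈⟨ -‿+-comm _ _ ⟩
          - (fromℕ a - fromℕ b)    ≈⟨ -‿cong (⟦⟧≈ a b) ⟨
          - ⟦ a , b ⟧              ∎
      ; 0-homo = refl
      ; 1-homo = refl
      }
      where
      open import Relation.Binary.Reasoning.Setoid setoid
      *+*-homo : ∀ a c b d → fromℕ (a ℕ.* c ℕ.+ b ℕ.* d) ≈ fromℕ a * fromℕ c + fromℕ b * fromℕ d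
      *+*-homo a c b d = trans (×-homo-+ 1# (a ℕ.* c) (b ℕ.* d)) (+-cong (×1-homo-* a c) (×1-homo-* b d))

    _coeff≟_ : ∀ p q → Maybe (⟦ p ⟧ ≈ ⟦ q ⟧)
    (a , b) coeff≟ (c , d) with a ℕ.+ d ℕ.≟ c ℕ.+ b
    ... | no  _  = nothing
    ... | yes eq = just (begin
      ⟦ a , b ⟧                                    ≈⟨ ⟦⟧≈ a b ⟩
      A - B                                        ≈⟨ +-identityʳ _ ⟨
      (A - B) + 0#                                 ≈⟨ +-congˡ (-‿inverseʳ D) ⟨
      (A - B) + (D - D)                            ≈⟨ x-y+z-w A B D D ⟨
      (A + D) - (B + D)
        ≈⟨ +-congʳ (trans (sym (×-homo-+ 1# a d)) (trans (×-congˡ eq) (×-homo-+ 1# c b))) ⟩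
      (C + B) - (B + D)                            ≈⟨ +-congˡ (-‿cong (+-comm B D)) ⟩
      (C + B) - (D + B)                            ≈⟨ x-y+z-w C D B B ⟩
      (C - D) + (B - B)                            ≈⟨ +-congˡ (-‿inverseʳ B) ⟩
      (C - D) + 0#                                 ≈⟨ +-identityʳ _ ⟩
      C - D                                        ≈⟨ ⟦⟧≈ c d ⟨
      ⟦ c , d ⟧                                    ∎)
      where
      open import Relation.Binary.Reasoning.Setoid setoid
      A = fromℕ a
      B = fromℕ b
      C = fromℕ c
      D = fromℕ d

  open RingSolver Coeff (fromCommutativeRing commutativeRing) homomorphism _coeff≟_ public
    using (Polynomial; solve; _:=_; _:+_; _:*_; _:-_; :-_; con)

  :1 : ∀ {n} → Polynomial n
  :1 = con (1 , 0)

  private variable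
    x y z w : Carrier
    n : ℕ

  -- Stands in for trichotomy: it is what lets the negative statement `y ≤ z` yield a strict
  -- inequality in `<-≤-trans` and `≤-<-trans`.
  <-cotrans : ∀ z → x < y → x < z ⊎ z < y
  <-cotrans {x} {y} z x<y with #-cotrans (≶⇒# (inj₁ x<y)) z
  ... | inj₁ x#z = [ inj₁ , (λ z<x → inj₂ (<-trans z<x x<y)) ]′ (#⇒≶ x#z)
  ... | inj₂ z#y = [ inj₂ , (λ y<z → inj₁ (<-trans x<y y<z)) ]′ (#⇒≶ z#y)

  <⇒≤ : x < y → x ≤ y
  <⇒≤ = <-asym

  ≤-reflexive : x ≈ y → x ≤ y
  ≤-reflexive x≈y y<x = <-irrefl (sym x≈y) y<x

  <-≤-trans : x < y → y ≤ z → x < z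
  <-≤-trans {z = z} x<y y≤z = [ (λ x<z → x<z) , (λ z<y → contradiction z<y y≤z) ]′ (<-cotrans z x<y)

  ≤-<-trans : x ≤ y → y < z → x < z
  ≤-<-trans {x = x} x≤y y<z = [ (λ y<x → contradiction y<x x≤y) , (λ x<z → x<z) ]′ (<-cotrans x y<z)

  ≤-trans : x ≤ y → y ≤ z → x ≤ z
  ≤-trans x≤y y≤z z<x = y≤z (<-≤-trans z<x x≤y)

  ≤-isPreorder : IsPreorder _≈_ _≤_
  ≤-isPreorder = record { isEquivalence = isEquivalence ; reflexive = ≤-reflexive ; trans = ≤-trans }

  module ≤-Reasoning = TripleReasoning ≤-isPreorder <-asym <-trans <-resp-≈ <⇒≤ <-≤-trans ≤-<-trans

  -- By tightness equality is the negation of apartness, so equations too may be proved by classical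
  -- case distinction.
  stable : ¬ ¬ (x ≈ y) → x ≈ y
  stable {x} {y} ¬¬x≈y = proj₁ (tight x y) λ x#y → ¬¬x≈y λ x≈y → proj₂ (tight x y) x≈y x#y

  ≤-antisym : x ≤ y → y ≤ x → x ≈ y
  ≤-antisym {x} {y} x≤y y≤x = proj₁ (tight x y) λ x#y → [ y≤x , x≤y ]′ (#⇒≶ x#y)

  ≤-total : ∀ x y → ¬ ¬ (x ≤ y ⊎ y ≤ x)
  ≤-total x y k = k (inj₁ λ y<x → k (inj₂ (<⇒≤ y<x)))

  compare : ∀ x y → ¬ ¬ (x < y ⊎ x ≈ y ⊎ y < x)
  compare x y k = k (inj₂ (inj₁ (proj₁ (tight x y) λ x#y →
    [ (λ x<y → k (inj₁ x<y)) , (λ y<x → k (inj₂ (inj₂ y<x))) ]′ (#⇒≶ x#y))))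

  +-monoʳ-< : ∀ x → y < z → x + y < x + z
  +-monoʳ-< x y<z = <-respʳ-≈ (+-comm _ x) (<-respˡ-≈ (+-comm _ x) (+-monoˡ-< x y<z))

  +-cancelʳ-< : ∀ z → x + z < y + z → x < y
  +-cancelʳ-< {x} {y} z lt = <-respʳ-≈ (cancel y z) (<-respˡ-≈ (cancel x z) (+-monoˡ-< (- z) lt))
    where
    cancel : ∀ x z → x + z + - z ≈ x
    cancel = solve 2 (λ x z → x :+ z :+ :- z := x) refl

  +-monoˡ-≤ : ∀ z → x ≤ y → x + z ≤ y + z
  +-monoˡ-≤ z x≤y lt = x≤y (+-cancelʳ-< z lt)

  +-monoʳ-≤ : ∀ z → x ≤ y → z + x ≤ z + y
  +-monoʳ-≤ z x≤y lt = +-monoˡ-≤ z x≤y (<-respʳ-≈ (+-comm z _) (<-respˡ-≈ (+-comm z _) lt))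

  +-mono-≤ : x ≤ y → z ≤ w → x + z ≤ y + w
  +-mono-≤ {y = y} {z} x≤y z≤w = ≤-trans (+-monoˡ-≤ z x≤y) (+-monoʳ-≤ y z≤w)

  +-cancelʳ-≤ : ∀ z → x + z ≤ y + z → x ≤ y
  +-cancelʳ-≤ z le y<x = le (+-monoˡ-< z y<x)

  x≤y⇒0≤y-x : x ≤ y → 0# ≤ y - x
  x≤y⇒0≤y-x {x} {y} x≤y = +-cancelʳ-≤ x (≤-trans (≤-reflexive (+-identityˡ x))
    (≤-trans x≤y (≤-reflexive (solve 2 (λ x y → y := y :- x :+ x) refl x y))))

  x<y⇒0<y-x : x < y → 0# < y - x
  x<y⇒0<y-x {x} {y} x<y = +-cancelʳ-< x (<-respˡ-≈ (sym (+-identityˡ x))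
    (<-respʳ-≈ (solve 2 (λ x y → y := y :- x :+ x) refl x y) x<y))

  0≤y-x⇒x≤y : 0# ≤ y - x → x ≤ y
  0≤y-x⇒x≤y {y} {x} le = ≤-trans (≤-reflexive (sym (+-identityˡ x))) (≤-trans (+-monoˡ-≤ x le)
    (≤-reflexive (solve 2 (λ x y → y :- x :+ x := y) refl x y)))

  0<1 : 0# < 1#
  0<1 with #⇒≶ 1#0
  ... | inj₂ 0<1 = 0<1
  ... | inj₁ 1<0 = contradiction (<-respʳ-≈ (solve 0 (:- :1 :* :- :1 := :1) refl) (*-pos 0<-1 0<-1)) (<-asym 1<0)
    where
    0<-1 : 0# < - 1#
    0<-1 = <-respʳ-≈ (+-identityˡ _) (x<y⇒0<y-x 1<0)

  -- The axiom `*-pos` covers only strictly positive factors. The conclusion is a negation, so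
  -- trichotomy of both factors may be used, and a zero factor makes the product zero.
  *-nonneg : 0# ≤ x → 0# ≤ y → 0# ≤ x * y
  *-nonneg {x} {y} 0≤x 0≤y xy<0 = compare 0# x λ where
    (inj₂ (inj₂ x<0)) → 0≤x x<0
    (inj₂ (inj₁ 0≈x)) → <-irrefl (trans (*-congʳ (sym 0≈x)) (zeroˡ y)) xy<0
    (inj₁ 0<x) → compare 0# y λ where
      (inj₂ (inj₂ y<0)) → 0≤y y<0
      (inj₂ (inj₁ 0≈y)) → <-irrefl (trans (*-congˡ (sym 0≈y)) (zeroʳ x)) xy<0
      (inj₁ 0<y) → <-asym xy<0 (*-pos 0<x 0<y)

  *-monoˡ-≤ : 0# ≤ z → x ≤ y → z * x ≤ z * y
  *-monoˡ-≤ {z} {x} {y} 0≤z x≤y = 0≤y-x⇒x≤y (≤-trans (*-nonneg 0≤z (x≤y⇒0≤y-x x≤y))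
    (≤-reflexive (solve 3 (λ x y z → z :* (y :- x) := z :* y :- z :* x) refl x y z)))

  *-monoʳ-≤ : 0# ≤ z → x ≤ y → x * z ≤ y * z
  *-monoʳ-≤ 0≤z x≤y =
    ≤-trans (≤-reflexive (*-comm _ _)) (≤-trans (*-monoˡ-≤ 0≤z x≤y) (≤-reflexive (*-comm _ _)))

  *-monoˡ-< : 0# < z → x < y → z * x < z * y
  *-monoˡ-< {z} {x} {y} 0<z x<y = +-cancelʳ-< (- (z * x)) (<-respˡ-≈ (sym (-‿inverseʳ _))
    (<-respʳ-≈ (solve 3 (λ x y z → z :* (y :- x) := z :* y :- z :* x) refl x y z) (*-pos 0<z (x<y⇒0<y-x x<y))))

  *-cancelˡ-≤ : 0# < z → z * x ≤ z * y → x ≤ y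
  *-cancelˡ-≤ 0<z le y<x = le (*-monoˡ-< 0<z y<x)

  -- The inverse is itself invertible, hence apart from 0, and a negative inverse of a positive
  -- element would give 1 < 0.
  ∃-inverse : 0# < x → ∃[ y ] 0# < y × y * x ≈ 1#
  ∃-inverse {x} 0<x with #⇒invertible (≶⇒# (inj₂ 0<x))
  ... | y , y*x≈1 , _ = y , 0<y , y*x≈1′
    where
    y*x≈1′ : y * x ≈ 1#
    y*x≈1′ = trans (*-congˡ (sym (x-0≈x x))) y*x≈1
    0<y : 0# < y
    0<y with <-cotrans y 0<1
    ... | inj₁ 0<y = 0<y
    ... | inj₂ y<1 with #⇒≶ (invertible⇒# {y} {0#} (x , trans (*-congˡ (x-0≈x y)) (trans (*-comm x y) y*x≈1′)
                                                      , trans (*-congʳ (x-0≈x y)) y*x≈1′))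
    ...   | inj₂ 0<y = 0<y
    ...   | inj₁ y<0 = contradiction 0<1
      (<⇒≤ (<-respʳ-≈ (zeroʳ x) (<-respˡ-≈ (trans (*-comm x y) y*x≈1′) (*-monoˡ-< 0<x y<0))))

  ∑-mono-≤ : {f g : Vector Carrier n} → (∀ i → f i ≤ g i) → sum f ≤ sum g
  ∑-mono-≤ {zero}  f≤g = ≤-reflexive refl
  ∑-mono-≤ {suc n} f≤g = +-mono-≤ (f≤g zero) (∑-mono-≤ (f≤g ∘ suc))

  ∑-nonneg : {f : Vector Carrier n} → (∀ i → 0# ≤ f i) → 0# ≤ sum f
  ∑-nonneg {zero}  0≤f = ≤-reflexive refl
  ∑-nonneg {suc n} 0≤f =
    ≤-trans (≤-reflexive (sym (+-identityˡ 0#))) (+-mono-≤ (0≤f zero) (∑-nonneg (0≤f ∘ suc)))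

  ∑-const : ∀ n x → sum {n} (λ _ → x) ≈ fromℕ n * x
  ∑-const zero    x = sym (zeroˡ x)
  ∑-const (suc n) x = trans (+-cong (sym (*-identityˡ x)) (∑-const n x)) (sym (distribʳ x 1# (fromℕ n)))

  fromℕ-cong : ∀ {a b} → a ≡ b → fromℕ a ≈ fromℕ b
  fromℕ-cong a≡b = reflexive (≡.cong fromℕ a≡b)

  fromℕ-1 : fromℕ 1 ≈ 1#
  fromℕ-1 = +-identityʳ 1#

  fromℕ-+ : ∀ a b → fromℕ (a ℕ.+ b) ≈ fromℕ a + fromℕ b
  fromℕ-+ = ×-homo-+ 1#

  fromℕ-* : ∀ a b → fromℕ (a ℕ.* b) ≈ fromℕ a * fromℕ b
  fromℕ-* = ×1-homo-*

  0≤fromℕ : ∀ a → 0# ≤ fromℕ a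
  0≤fromℕ zero    = ≤-reflexive refl
  0≤fromℕ (suc a) = ≤-trans (≤-reflexive (sym (+-identityˡ 0#))) (+-mono-≤ (<⇒≤ 0<1) (0≤fromℕ a))

  fromℕ-mono-≤ : ∀ {a b} → a ℕ.≤ b → fromℕ a ≤ fromℕ b
  fromℕ-mono-≤ {b = b} z≤n = 0≤fromℕ b
  fromℕ-mono-≤ (s≤s a≤b) = +-monoʳ-≤ 1# (fromℕ-mono-≤ a≤b)

  fromℕ-mono-< : ∀ {a b} → a ℕ.< b → fromℕ a < fromℕ b
  fromℕ-mono-< {a} a<b = <-≤-trans (<-respˡ-≈ (+-identityˡ _) (+-monoˡ-< (fromℕ a) 0<1)) (fromℕ-mono-≤ a<b)

  fromℕ-cancel-≤ : ∀ {a b} → fromℕ a ≤ fromℕ b → a ℕ.≤ b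
  fromℕ-cancel-≤ le = ℕ.≮⇒≥ λ b<a → le (fromℕ-mono-< b<a)

  private
    only-zero : ∀ {p} (P : Fin (suc n) → Set p) i → P i → ¬ ∃ (P ∘ suc) → P zero
    only-zero P zero    p₀ ¬tail = p₀
    only-zero P (suc i) pᵢ ¬tail = contradiction (i , pᵢ) ¬tail

  -- Finite minima exist only up to double negation, as _<_ is not decidable.
  argmin : ∀ {p} {n} (P : Fin n → Set p) (f : Vector Carrier n) → ∃ P →
    ¬ ¬ (∃[ i ] P i × (∀ j → P j → f i ≤ f j))
  argmin {n = suc n} P f (i , pᵢ) k = ¬¬-excluded-middle {A = ∃ (P ∘ suc)} λ where
    (no ¬tail) → k (zero , only-zero P i pᵢ ¬tail ,
      λ { zero _ → ≤-reflexive refl ; (suc l) pₗ → contradiction (l , pₗ) ¬tail })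
    (yes tail) → argmin (P ∘ suc) (f ∘ suc) tail λ (j , pⱼ , min) → ¬¬-excluded-middle {A = P zero} λ where
      (no ¬p₀) → k (suc j , pⱼ , λ { zero p₀ → contradiction p₀ ¬p₀ ; (suc l) → min l })
      (yes p₀) → ≤-total (f zero) (f (suc j)) λ where
        (inj₁ le) → k (zero , p₀ , λ { zero _ → ≤-reflexive refl ; (suc l) pₗ → ≤-trans le (min l pₗ) })
        (inj₂ ge) → k (suc j , pⱼ , λ { zero _ → ge ; (suc l) → min l })

-- Minimising a linear functional over a polyhedron.

module LinearMinimum {c ℓ₁ ℓ₂} (ℝ : RealNumbers c ℓ₁ ℓ₂) where
  open RealNumbers ℝ hiding (zero; complete)
  open RealProperties ℝ
  open Modulus ℝ

  private variable
    m : ℕ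

  record IsLinear (L : Vector Carrier m → Carrier) : Set (c ⊔ ℓ₁) where
    field
      cong   : ∀ {x y} → (∀ e → x e ≈ y e) → L x ≈ L y
      +-homo : ∀ x y → L (λ e → x e + y e) ≈ L x + L y
      *-homo : ∀ a x → L (λ e → a * x e) ≈ a * L x

    combination : ∀ a b x y → L (λ e → a * x e + b * y e) ≈ a * L x + b * L y
    combination a b x y = trans (+-homo _ _) (+-cong (*-homo a x) (*-homo b y))

  coordinate-linear : ∀ e → IsLinear {m} (λ x → x e)
  coordinate-linear e = record { cong = λ x≈y → x≈y e ; +-homo = λ _ _ → refl ; *-homo = λ _ _ → refl }

  zero-linear : IsLinear {m} (λ _ → 0#)
  zero-linear =
    record { cong = λ _ → refl ; +-homo = λ _ _ → sym (+-identityˡ 0#) ; *-homo = λ a _ → sym (zeroʳ a) }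

  pairing-linear : (γ : Vector Carrier m) → IsLinear (λ x → sum λ e → γ e * x e)
  pairing-linear γ = record
    { cong   = λ x≈y → sum-cong-≋ λ e → *-congˡ (x≈y e)
    ; +-homo = λ x y → trans (sum-cong-≋ λ e → distribˡ (γ e) (x e) (y e))
                             (∑-distrib-+ (λ e → γ e * x e) (λ e → γ e * y e))
    ; *-homo = λ a x → trans (sum-cong-≋ λ e → solve 3 (λ g a x → g :* (a :* x) := a :* (g :* x)) refl (γ e) a (x e))
                             (sym (*-distribˡ-sum a (λ e → γ e * x e)))
    }

  -- `coordinate` puts every coordinate among the constraint functionals, so each is bounded below
  -- on `C`. Hence `C` contains no line, and a move that decreases some coordinate must eventually
  -- meet a constraint.
  record IsPolyhedron {ℓ} (C : Pred (Vector Carrier m) ℓ) : Set (c ⊔ ℓ₁ ⊔ ℓ₂ ⊔ ℓ) where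
    field
      #constraints : ℕ
      L            : Fin #constraints → Vector Carrier m → Carrier
      β            : Fin #constraints → Carrier
      linear       : ∀ j → IsLinear (L j)
      sound        : ∀ {x} → C x → ∀ j → β j ≤ L j x
      complete     : ∀ {x} → (∀ j → β j ≤ L j x) → C x
      coordinate   : ∀ e → ∃[ j ] ∀ x → L j x ≈ x e

  -- From a point that is not extreme, move along a direction in which f does
  -- not increase and some coordinate decreases, until a new constraint becomes
  -- tight; the constraints that were tight remain so.
  minimum-at-extreme-point :
    ∀ {ℓ} {C : Pred (Vector Carrier m) ℓ} {f : Vector Carrier m → Carrier} {b} →
    IsPolyhedron C → IsLinear f → (∀ {x y} → (∀ e → x e ≤ y e) → f x ≤ f y) →
    (∀ ξ → IsExtremePoint C ξ → b ≤ f ξ) → ∀ ρ → C ρ → b ≤ f ρ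
  minimum-at-extreme-point {m} {ℓ} {C} {f} {b} polyhedron f-linear f-mono bound ρ₀ Cρ₀ =
    go Data.Fin.Subset.⊥ (⊃-wellFounded _) ρ₀ Cρ₀ λ j j∈⊥ → contradiction j∈⊥ Subset.∉⊥
    where
    open IsPolyhedron polyhedron

    shift : Carrier → (ρ x y : Vector Carrier m) → Vector Carrier m
    shift s ρ x y e = ρ e + (s * x e + - s * y e)

    shift-homo : ∀ {g : Vector Carrier m → Carrier} → IsLinear g → ∀ s ρ x y →
      g (shift s ρ x y) ≈ g ρ - s * (g y - g x)
    shift-homo {g} g-linear s ρ x y = trans (IsLinear.+-homo g-linear _ _)
      (trans (+-congˡ (IsLinear.combination g-linear s (- s) x y))
             (solve 4 (λ gρ s gx gy → gρ :+ (s :* gx :+ :- s :* gy) := gρ :- s :* (gy :- gx)) refl _ s _ _))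

    -- Applied to a segment through `ρ`: a constraint tight at an interior point is tight at both
    -- ends, since an excess at one end cannot be compensated below `β` at the other.
    tight-endpoint : ∀ {β u v w t} → u ≈ t * v + (1# - t) * w → 0# < t → t < 1# →
      β ≤ v → β ≤ w → u ≈ β → v ≈ β
    tight-endpoint {β} {u} {v} {w} {t} u≈ 0<t t<1 β≤v β≤w u≈β = ≤-antisym v≤β β≤v
      where
      open ≤-Reasoning
      v≤β : v ≤ β
      v≤β = *-cancelˡ-≤ 0<t (+-cancelʳ-≤ ((1# - t) * w) (begin
        t * v + (1# - t) * w ≈⟨ u≈ ⟨
        u                    ≈⟨ u≈β ⟩
        β                    ≈⟨ solve 2 (λ t β → β := t :* β :+ (:1 :- t) :* β) refl t β ⟩
        t * β + (1# - t) * β ≤⟨ +-monoʳ-≤ (t * β) (*-monoˡ-≤ (<⇒≤ (x<y⇒0<y-x t<1)) β≤w) ⟩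
        t * β + (1# - t) * w ∎))

    go : ∀ T → Acc _⊃_ T → ∀ ρ → C ρ → (∀ j → j ∈ T → L j ρ ≈ β j) → b ≤ f ρ
    -- The goal `b ≤ f ρ` is a negation, so `f ρ < b` is available while proving that `ρ` is
    -- extreme. Any failure of extremality yields a feasible point with a larger set of tight
    -- constraints and `f` still below `b`, which the recursive call refutes.
    go T (acc rec) ρ Cρ tightT fρ<b = bound ρ (Cρ , extreme) fρ<b
      where
      move : ∀ x y → (∀ j → j ∈ T → L j x ≈ L j y) → f x ≤ f y → ∃[ e ] x e < y e → ⊥
      move x y ≈T fx≤fy (e , x<y) = ¬¬-∀Fin ratio-exists λ ratios →
        argmin Decreases (proj₁ ∘ ratios) (j₀ , <-respˡ-≈ (sym (L₀≈ x)) (<-respʳ-≈ (sym (L₀≈ y)) x<y)) (step ratios)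
        where
        j₀ : Fin #constraints
        j₀ = proj₁ (coordinate e)

        L₀≈ : ∀ x → L j₀ x ≈ x e
        L₀≈ = proj₂ (coordinate e)

        Decreases : Fin #constraints → Set ℓ₂
        Decreases j = L j x < L j y

        -- The ratio test of the simplex method: `s` is the step length in direction x - y at which
        -- constraint `j` becomes tight. The least ratio among the decreasing constraints is the
        -- step taken.
        Ratio : Fin #constraints → Carrier → Set (ℓ₁ ⊔ ℓ₂)
        Ratio j s = Decreases j → 0# ≤ s × s * (L j y - L j x) ≈ L j ρ - β j

        ratio-exists : ∀ j → ¬ ¬ ∃ (Ratio j)
        ratio-exists j k = ¬¬-excluded-middle λ where
          (no ¬d) → k (0# , λ d → contradiction d ¬d)
          (yes d) → case ∃-inverse (x<y⇒0<y-x d) of λ (i , 0<i , i*≈1) →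
            k ((L j ρ - β j) * i , λ _ → *-nonneg (x≤y⇒0≤y-x (sound Cρ j)) (<⇒≤ 0<i)
              , trans (*-assoc _ _ _) (trans (*-congˡ i*≈1) (*-identityʳ _)))

        step : (ratios : ∀ j → ∃ (Ratio j)) →
          ¬ (∃[ j ] Decreases j × (∀ l → Decreases l → proj₁ (ratios j) ≤ proj₁ (ratios l)))
        step ratios (j , d , min) =
          go (T ∪ ⁅ j ⁆) (rec (Subset.p⊆p∪q _ , j , Subset.q⊆p∪q T _ (Subset.x∈⁅x⁆ j) , j∉T))
             ρ′ (complete Cρ′) tight′ (≤-<-trans fρ′≤fρ fρ<b)
          where
          open ≤-Reasoning

          s : Carrier
          s = proj₁ (ratios j)

          0≤s : 0# ≤ s
          0≤s = proj₁ (proj₂ (ratios j) d)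

          ρ′ : Vector Carrier m
          ρ′ = shift s ρ x y

          j∉T : j ∉ T
          j∉T j∈T = <-irrefl (≈T j j∈T) d

          -- A decreasing constraint survives because `s` is at most its own ratio; any other
          -- constraint can only gain, because `s` is nonnegative.
          Cρ′ : ∀ l → β l ≤ L l ρ′
          Cρ′ l lt = ¬¬-excluded-middle λ where
              (yes d′) → 0≤y-x⇒x≤y (begin
                0#                                              ≈⟨ -‿inverseʳ _ ⟨
                s * D - s * D
                  ≤⟨ +-monoˡ-≤ (- (s * D)) (*-monoʳ-≤ (<⇒≤ (x<y⇒0<y-x d′)) (min l d′)) ⟩
                proj₁ (ratios l) * D - s * D                    ≈⟨ +-congʳ (proj₂ (proj₂ (ratios l) d′)) ⟩
                (L l ρ - β l) - s * D
                  ≈⟨ solve 3 (λ r b q → (r :- b) :- q := (r :- q) :- b) refl _ _ _ ⟩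
                (L l ρ - s * D) - β l                           ≈⟨ +-congʳ (shift-homo (linear l) s ρ x y) ⟨
                L l ρ′ - β l                                    ∎) lt
              (no ¬d′) → (begin
                β l                                             ≤⟨ sound Cρ l ⟩
                L l ρ                                           ≈⟨ +-identityʳ _ ⟨
                L l ρ + 0#
                  ≤⟨ +-monoʳ-≤ (L l ρ) (*-nonneg 0≤s (x≤y⇒0≤y-x ¬d′)) ⟩
                L l ρ + s * (L l x - L l y)
                  ≈⟨ solve 4 (λ r s u v → r :+ s :* (u :- v) := r :- s :* (v :- u)) refl _ _ _ _ ⟩
                L l ρ - s * D                                   ≈⟨ shift-homo (linear l) s ρ x y ⟨
                L l ρ′                                          ∎) lt
            where
            D : Carrier
            D = L l y - L l x

          tight′ : ∀ l → l ∈ T ∪ ⁅ j ⁆ → L l ρ′ ≈ β l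
          tight′ l l∈T′ = trans (shift-homo (linear l) s ρ x y) ([ old , new ]′ (Subset.x∈p∪q⁻ T _ l∈T′))
            where
            old : l ∈ T → L l ρ - s * (L l y - L l x) ≈ β l
            old l∈T = trans (+-congˡ (-‿cong (*-congˡ (+-congˡ (-‿cong (≈T l l∈T))))))
              (trans (solve 3 (λ r s u → r :- s :* (u :- u) := r) refl _ _ _) (tightT l l∈T))
            new : l ∈ ⁅ j ⁆ → L l ρ - s * (L l y - L l x) ≈ β l
            new l∈ with ≡.refl ← Subset.x∈⁅y⁆⇒x≡y j l∈ =
              trans (+-congˡ (-‿cong (proj₂ (proj₂ (ratios j) d)))) (solve 2 (λ r b → r :- (r :- b) := b) refl _ _)

          fρ′≤fρ : f ρ′ ≤ f ρ
          fρ′≤fρ = 0≤y-x⇒x≤y (begin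
            0#                                  ≤⟨ *-nonneg 0≤s (x≤y⇒0≤y-x fx≤fy) ⟩
            s * (f y - f x)                     ≈⟨ solve 2 (λ r q → q := r :- (r :- q)) refl (f ρ) _ ⟩
            f ρ - (f ρ - s * (f y - f x))       ≈⟨ +-congˡ (-‿cong (shift-homo f-linear s ρ x y)) ⟨
            f ρ - f ρ′                          ∎)

      -- The direction must lower some coordinate without raising `f`. If y - x has both signs, both
      -- directions lower a coordinate and one of them does not raise `f`. If x ≤ y throughout, only
      -- the direction x - y is possible, and monotonicity of `f` makes it suitable.
      tryMove : ∀ x y → (∀ j → j ∈ T → L j x ≈ L j y) → ∃[ e ] x e < y e → ⊥
      tryMove x y ≈T x<y = ¬¬-excluded-middle {A = ∃[ e ] y e < x e} λ where
        (no ¬y<x) → move x y ≈T (f-mono λ e y<x → ¬y<x (e , y<x)) x<y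
        (yes y<x) → ≤-total (f x) (f y) λ where
          (inj₁ fx≤fy) → move x y ≈T fx≤fy x<y
          (inj₂ fy≤fx) → move y x (λ j j∈T → sym (≈T j j∈T)) fy≤fx y<x

      extreme : ∀ x y t → C x → C y → 0# < t → t < 1# →
        (∀ e → ρ e ≈ t * x e + (1# - t) * y e) → ∀ e → x e ≈ y e
      extreme x y t Cx Cy 0<t t<1 ρ≈ e = stable λ x≉y → compare (x e) (y e) λ where
          (inj₁ x<y)        → tryMove x y ≈T (e , x<y)
          (inj₂ (inj₁ x≈y)) → x≉y x≈y
          (inj₂ (inj₂ y<x)) → tryMove y x (λ j j∈T → sym (≈T j j∈T)) (e , y<x)
        where
        ≈T : ∀ j → j ∈ T → L j x ≈ L j y
        ≈T j j∈T = trans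
          (tight-endpoint Lρ≈ 0<t t<1 (sound Cx j) (sound Cy j) (tightT j j∈T))
          (sym (tight-endpoint Lρ≈′ (x<y⇒0<y-x t<1) 1-t<1 (sound Cy j) (sound Cx j) (tightT j j∈T)))
          where
          Lρ≈ : L j ρ ≈ t * L j x + (1# - t) * L j y
          Lρ≈ = trans (IsLinear.cong (linear j) ρ≈) (IsLinear.combination (linear j) _ _ x y)
          Lρ≈′ : L j ρ ≈ (1# - t) * L j y + (1# - (1# - t)) * L j x
          Lρ≈′ = trans Lρ≈ (solve 3 (λ t u v → t :* u :+ (:1 :- t) :* v :=
            (:1 :- t) :* v :+ (:1 :- (:1 :- t)) :* u) refl t _ _)
          1-t<1 : 1# - t < 1#
          1-t<1 = +-cancelʳ-< t (<-respˡ-≈ (solve 1 (λ t → :1 := :1 :- t :+ t) refl t)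
            (<-respˡ-≈ (+-identityʳ 1#) (+-monoʳ-< 1# 0<t)))

-- Counting with indicators; strength and arboricity against the balance condition.

module Counting where
  open import Data.Nat.Base using (_+_; _*_; _∸_; _≤_; _<_)
  open ≡ using (refl; sym; trans; cong; cong₂; subst)

  private variable
    n : ℕ
    P Q : Set

  indicator : Dec P → ℕ
  indicator d = if does d then 1 else 0

  indicator-yes : (d : Dec P) → P → indicator d ≡ 1
  indicator-yes d p = cong (λ b → if b then 1 else 0) (dec-true d p)

  indicator-no : (d : Dec P) → ¬ P → indicator d ≡ 0
  indicator-no d ¬p = cong (λ b → if b then 1 else 0) (dec-false d ¬p)

  indicator-≤1 : (d : Dec P) → indicator d ≤ 1
  indicator-≤1 (yes _) = ℕ.≤-refl
  indicator-≤1 (no  _) = z≤n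

  indicator-mono : (d : Dec P) (d′ : Dec Q) → (P → Q) → indicator d ≤ indicator d′
  indicator-mono (yes p) d′ f = ℕ.≤-reflexive (sym (indicator-yes d′ (f p)))
  indicator-mono (no _)  d′ f = z≤n

  indicator-cong : (d : Dec P) (d′ : Dec Q) → (P → Q) → (Q → P) → indicator d ≡ indicator d′
  indicator-cong d d′ f g = ℕ.≤-antisym (indicator-mono d d′ f) (indicator-mono d′ d g)

  ∑-mono : {f g : Vector ℕ n} → (∀ i → f i ≤ g i) → ℕ∑.sum f ≤ ℕ∑.sum g
  ∑-mono {zero}  f≤g = z≤n
  ∑-mono {suc n} f≤g = ℕ.+-mono-≤ (f≤g zero) (∑-mono (f≤g ∘ suc))

  term≤∑ : (f : Vector ℕ n) → ∀ i → f i ≤ ℕ∑.sum f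
  term≤∑ f zero    = ℕ.m≤m+n (f zero) _
  term≤∑ f (suc i) = ℕ.≤-trans (term≤∑ (f ∘ suc) i) (ℕ.m≤n+m _ (f zero))

  ∑-constℕ : ∀ n x → ℕ∑.sum {n} (λ _ → x) ≡ n * x
  ∑-constℕ zero    x = refl
  ∑-constℕ (suc n) x = cong (x +_) (∑-constℕ n x)

  ∑-indicator-none : {P : Fin n → Set} (P? : ∀ i → Dec (P i)) → (∀ i → ¬ P i) → ℕ∑.sum (λ i → indicator (P? i)) ≡ 0
  ∑-indicator-none {n} P? none =
    trans (ℕ∑.sum-cong-≗ λ i → indicator-no (P? i) (none i)) (ℕ∑.sum-replicate-zero n)

  ∑-indicator-≤1 : {P : Fin n → Set} (P? : ∀ i → Dec (P i)) → (∀ i j → P i → P j → i ≡ j) →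
    ℕ∑.sum (λ i → indicator (P? i)) ≤ 1
  ∑-indicator-≤1 {zero}  P? unique = z≤n
  ∑-indicator-≤1 {suc n} P? unique with P? zero
  ... | no  _  = ∑-indicator-≤1 (P? ∘ suc) λ i j pᵢ pⱼ → Fin.suc-injective (unique _ _ pᵢ pⱼ)
  ... | yes p₀ = ℕ.≤-reflexive (cong suc (∑-indicator-none (P? ∘ suc) λ i pᵢ → Fin.0≢1+n (unique zero (suc i) p₀ pᵢ)))

  ∑-indicator-≥1 : {P : Fin n → Set} (P? : ∀ i → Dec (P i)) → ∀ i → P i → 1 ≤ ℕ∑.sum (λ i → indicator (P? i))
  ∑-indicator-≥1 P? i pᵢ = ℕ.≤-trans (ℕ.≤-reflexive (sym (indicator-yes (P? i) pᵢ))) (term≤∑ _ i)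

  ∑-indicator-≡1 : ∀ (i : Fin n) → ℕ∑.sum (λ j → indicator (i Fin.≟ j)) ≡ 1
  ∑-indicator-≡1 i = ℕ.≤-antisym (∑-indicator-≤1 (i Fin.≟_) λ j k i≡j i≡k → trans (sym i≡j) i≡k)
                                 (∑-indicator-≥1 (i Fin.≟_) i refl)

  ∣p∣≡∑ : (p : Subset n) → ∣ p ∣ ≡ ℕ∑.sum (λ i → indicator (i ∈? p))
  ∣p∣≡∑ []          = refl
  ∣p∣≡∑ (true  ∷ p) = cong suc (∣p∣≡∑ p)
  ∣p∣≡∑ (false ∷ p) = ∣p∣≡∑ p

  ∣tabulate∣≡∑ : {P : Fin n → Set} (P? : ∀ i → Dec (P i)) →
    ∣ tabulate (λ i → does (P? i)) ∣ ≡ ℕ∑.sum (λ i → indicator (P? i))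
  ∣tabulate∣≡∑ {zero}  P? = refl
  ∣tabulate∣≡∑ {suc n} P? with does (P? zero)
  ... | true  = cong suc (∣tabulate∣≡∑ (P? ∘ suc))
  ... | false = ∣tabulate∣≡∑ (P? ∘ suc)

  ∈-tabulate⁺ : {P : Fin n → Set} (P? : ∀ i → Dec (P i)) → ∀ {i} → P i → i ∈ tabulate (λ i → does (P? i))
  ∈-tabulate⁺ P? {i} pᵢ = Vec.lookup⇒[]= i _ (trans (Vec.lookup∘tabulate _ i) (dec-true (P? i) pᵢ))

  ∈-tabulate⁻ : {P : Fin n → Set} (P? : ∀ i → Dec (P i)) → ∀ {i} → i ∈ tabulate (λ i → does (P? i)) → P i
  ∈-tabulate⁻ P? {i} i∈ with P? i | trans (sym (Vec.lookup∘tabulate (λ i → does (P? i)) i)) (Vec.[]=⇒lookup i∈)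
  ... | yes pᵢ | _  = pᵢ
  ... | no  _  | ()

  1≤∣p∣⇒Nonempty : {p : Subset n} → 1 ≤ ∣ p ∣ → Nonempty p
  1≤∣p∣⇒Nonempty {n} {p} 1≤∣p∣ with Subset.nonempty? p
  ... | yes ne = ne
  ... | no ¬ne = contradiction 1≤∣p∣
    (ℕ.<⇒≱ (subst (_< 1) (sym (trans (cong ∣_∣ (Subset.Empty-unique ¬ne)) (Subset.∣⊥∣≡0 n))) (s≤s z≤n)))

  Nonempty⇒1≤∣p∣ : {p : Subset n} → Nonempty p → 1 ≤ ∣ p ∣
  Nonempty⇒1≤∣p∣ {p = p} (i , i∈p) = ℕ.≤-trans (ℕ.≤-reflexive (sym (Subset.∣⁅x⁆∣≡1 i)))
    (Subset.p⊆q⇒∣p∣≤∣q∣ λ j∈ → subst (_∈ p) (sym (Subset.x∈⁅y⁆⇒x≡y i j∈)) i∈p)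

  ratio-mono : ∀ {a b k l} (2≤k : 2 ≤ k) (2≤l : 2 ≤ l) →
    a * (l ∸ 1) ≤ b * (k ∸ 1) → ratio a k 2≤k ℚ.≤ ratio b l 2≤l
  ratio-mono {a} {b} {suc (suc k)} {suc (suc l)} (s≤s (s≤s _)) (s≤s (s≤s _)) le = ℚ.toℚᵘ-cancel-≤
    (ℚᵘ.≤-respˡ-≃ (ℚᵘ.≃-sym (ℚ.toℚᵘ-fromℚᵘ (ℚᵘ.mkℚᵘ (ℤ.+ a) k)))
    (ℚᵘ.≤-respʳ-≃ (ℚᵘ.≃-sym (ℚ.toℚᵘ-fromℚᵘ (ℚᵘ.mkℚᵘ (ℤ.+ b) l)))
      (ℚᵘ.*≤* (≡.subst₂ ℤ._≤_ (ℤ.pos-* a (suc l)) (ℤ.pos-* b (suc k)) (ℤ.+≤+ le)))))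

  ratio-cancel : ∀ {a b k l} (2≤k : 2 ≤ k) (2≤l : 2 ≤ l) →
    ratio a k 2≤k ℚ.≤ ratio b l 2≤l → a * (l ∸ 1) ≤ b * (k ∸ 1)
  ratio-cancel {a} {b} {suc (suc k)} {suc (suc l)} (s≤s (s≤s _)) (s≤s (s≤s _)) le
    with ℚᵘ.*≤* le′ ← ℚᵘ.≤-respˡ-≃ (ℚ.toℚᵘ-fromℚᵘ (ℚᵘ.mkℚᵘ (ℤ.+ a) k))
                     (ℚᵘ.≤-respʳ-≃ (ℚ.toℚᵘ-fromℚᵘ (ℚᵘ.mkℚᵘ (ℤ.+ b) l)) (ℚ.toℚᵘ-mono-≤ le))
    = ℤ.drop‿+≤+ (≡.subst₂ ℤ._≤_ (sym (ℤ.pos-* a (suc l))) (sym (ℤ.pos-* b (suc k))) le′)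

  ratio-cong : ∀ {a b k l} (2≤k : 2 ≤ k) (2≤l : 2 ≤ l) → a ≡ b → k ≡ l → ratio a k 2≤k ≡ ratio b l 2≤l
  ratio-cong 2≤k 2≤l refl refl = cong (ratio _ _) (ℕ.≤-irrelevant 2≤k 2≤l)

  module _ (H : Hypergraph) where
    open Hypergraph H
    open Partition

    edge-nonempty : ∀ e → Nonempty (edge e)
    edge-nonempty e = 1≤∣p∣⇒Nonempty (ℕ.<⇒≤ (edge-size≥2 e))

    edge⊆⇒2≤ : ∀ {X e} → edge e ⊆ X → 2 ≤ ∣ X ∣
    edge⊆⇒2≤ {e = e} e⊆X = ℕ.≤-trans (edge-size≥2 e) (Subset.p⊆q⇒∣p∣≤∣q∣ e⊆X)

    -- The constant vector (∣V∣ - 1) / ∣E∣ satisfies the hyperforest inequalities.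
    Balanced : Set
    Balanced = ∀ X → Nonempty X → (∣V∣ ∸ 1) * ∣ E[ H ] X ∣ + ∣E∣ ≤ ∣E∣ * ∣ X ∣

    ∣E[X]∣≡∑ : ∀ X → ∣ E[ H ] X ∣ ≡ ℕ∑.sum (λ e → indicator (edge e ⊆? X))
    ∣E[X]∣≡∑ X = ∣tabulate∣≡∑ λ e → edge e ⊆? X

    1+[∣V∣∸1]≡∣V∣ : 1 + (∣V∣ ∸ 1) ≡ ∣V∣
    1+[∣V∣∸1]≡∣V∣ = ℕ.suc-pred ∣V∣ {{V-nonempty}}

    singletons : Partition ∣V∣
    singletons = record
      { #parts   = ∣V∣
      ; part     = ⁅_⁆
      ; nonempty = λ v → v , Subset.x∈⁅x⁆ v
      ; disjoint = λ u v w w∈u w∈v → trans (sym (Subset.x∈⁅y⁆⇒x≡y u w∈u)) (Subset.x∈⁅y⁆⇒x≡y v w∈v)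
      ; cover    = λ v → v , Subset.x∈⁅x⁆ v
      }

    inside-or-crosses : ∀ P e → ¬ Crosses H P e → ∃[ i ] edge e ⊆ part P i
    inside-or-crosses P e ¬crosses with v , v∈e ← edge-nonempty e with i , v∈Pᵢ ← cover P v = i , inside
      where
      inside : edge e ⊆ part P i
      inside {u} u∈e with j , u∈Pⱼ ← cover P u with i Fin.≟ j
      ... | yes refl = u∈Pⱼ
      ... | no  i≢j  = contradiction
        (i , j , i≢j , (v , Subset.x∈p∩q⁺ (v∈e , v∈Pᵢ)) , (u , Subset.x∈p∩q⁺ (u∈e , u∈Pⱼ))) ¬crosses

    ∣δ∣≡∑ : ∀ P → ∣ δ H P ∣ ≡ ℕ∑.sum (λ e → indicator (crosses? H P e))
    ∣δ∣≡∑ P = ∣tabulate∣≡∑ (crosses? H P)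

    ∣δ-singletons∣ : ∣ δ H singletons ∣ ≡ ∣E∣
    ∣δ-singletons∣ = begin
      ∣ δ H singletons ∣                                    ≡⟨ ∣δ∣≡∑ singletons ⟩
      ℕ∑.sum (λ e → indicator (crosses? H singletons e))
        ≡⟨ ℕ∑.sum-cong-≗ (λ e → indicator-yes (crosses? H singletons e) (crosses e)) ⟩
      ℕ∑.sum {∣E∣} (λ _ → 1)                                ≡⟨ ∑-constℕ ∣E∣ 1 ⟩
      ∣E∣ * 1                                              ≡⟨ ℕ.*-identityʳ ∣E∣ ⟩
      ∣E∣                                                  ∎
      where
      open ≡.≡-Reasoning
      crosses : ∀ e → Crosses H singletons e
      crosses e with crosses? H singletons e
      ... | yes c = c
      ... | no ¬c with v , e⊆v ← inside-or-crosses singletons e ¬c =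
        contradiction (edge⊆⇒2≤ {⁅ v ⁆} {e} e⊆v) (ℕ.<⇒≱ (ℕ.≤-reflexive (cong suc (Subset.∣⁅x⁆∣≡1 v))))

    ∣E[⊤]∣ : ∣ E[ H ] ⊤ ∣ ≡ ∣E∣
    ∣E[⊤]∣ = trans (∣E[X]∣≡∑ ⊤) (trans
      (ℕ∑.sum-cong-≗ λ e → indicator-yes (edge e ⊆? ⊤) (Subset.⊆-max (edge e)))
      (trans (∑-constℕ ∣E∣ 1) (ℕ.*-identityʳ ∣E∣)))

    parts-≤ : ∀ P → ℕ∑.sum (λ i → ∣ part P i ∣) ≤ ∣V∣
    parts-≤ P = begin
      ℕ∑.sum (λ i → ∣ part P i ∣)                                ≡⟨ ℕ∑.sum-cong-≗ (λ i → ∣p∣≡∑ (part P i)) ⟩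
      ℕ∑.sum (λ i → ℕ∑.sum λ v → indicator (v ∈? part P i))
        ≡⟨ ℕ∑.∑-comm (λ i v → indicator (v ∈? part P i)) ⟩
      ℕ∑.sum (λ v → ℕ∑.sum λ i → indicator (v ∈? part P i))
        ≤⟨ ∑-mono {∣V∣} (λ v → ∑-indicator-≤1 (λ i → v ∈? part P i) λ i j → disjoint P i j v) ⟩
      ℕ∑.sum {∣V∣} (λ _ → 1)
        ≡⟨ trans (∑-constℕ ∣V∣ 1) (ℕ.*-identityʳ ∣V∣) ⟩
      ∣V∣                                                      ∎
      where open ℕ.≤-Reasoning

    ∣E∣≤δ+∑E[part] : ∀ P → ∣E∣ ≤ ∣ δ H P ∣ + ℕ∑.sum (λ i → ∣ E[ H ] (part P i) ∣)
    ∣E∣≤δ+∑E[part] P = begin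
      ∣E∣
        ≡⟨ trans (∑-constℕ ∣E∣ 1) (ℕ.*-identityʳ ∣E∣) ⟨
      ℕ∑.sum {∣E∣} (λ _ → 1)                                                        ≤⟨ ∑-mono pointwise ⟩
      ℕ∑.sum (λ e → crossing e + ℕ∑.sum (λ i → indicator (edge e ⊆? part P i)))
        ≡⟨ ℕ∑.∑-distrib-+ crossing _ ⟩
      ℕ∑.sum crossing + ℕ∑.sum (λ e → ℕ∑.sum λ i → indicator (edge e ⊆? part P i))
        ≡⟨ cong₂ _+_ (sym (∣δ∣≡∑ P)) (ℕ∑.∑-comm (λ e i → indicator (edge e ⊆? part P i))) ⟩
      ∣ δ H P ∣ + ℕ∑.sum (λ i → ℕ∑.sum λ e → indicator (edge e ⊆? part P i))
        ≡⟨ cong (∣ δ H P ∣ +_) (ℕ∑.sum-cong-≗ λ i → ∣E[X]∣≡∑ (part P i)) ⟨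
      ∣ δ H P ∣ + ℕ∑.sum (λ i → ∣ E[ H ] (part P i) ∣)                              ∎
      where
      open ℕ.≤-Reasoning
      crossing : Vector ℕ ∣E∣
      crossing e = indicator (crosses? H P e)
      pointwise : ∀ e → 1 ≤ crossing e + ℕ∑.sum (λ i → indicator (edge e ⊆? part P i))
      pointwise e with crosses? H P e
      ... | yes _ = s≤s z≤n
      ... | no ¬c with i , e⊆ ← inside-or-crosses P e ¬c = ∑-indicator-≥1 (λ i → edge e ⊆? part P i) i e⊆

    -- Every hyperedge crosses `P` or lies inside a part. Summing `Balanced` over the parts gives N
    -- (∣E∣ - ∣δ∣) ≤ ∣E∣ (∣V∣ - #parts), which rearranges to the claim. It says that no partition
    -- has a ratio below ∣E∣ / N.
    balanced⇒δ : Balanced → ∀ P → ∣E∣ * (#parts P ∸ 1) ≤ ∣ δ H P ∣ * (∣V∣ ∸ 1)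
    balanced⇒δ balanced P = goal
      where
      open ℕ.≤-Reasoning
      N Σₑ D : ℕ
      N  = ∣V∣ ∸ 1
      Σₑ = ℕ∑.sum (λ i → ∣ E[ H ] (part P i) ∣)
      D  = ∣ δ H P ∣

      ∑-balanced : N * Σₑ + #parts P * ∣E∣ ≤ ∣E∣ * ∣V∣
      ∑-balanced = begin
        N * Σₑ + #parts P * ∣E∣
          ≡⟨ cong₂ _+_ (ℕ∑.*-distribˡ-sum N (λ i → ∣ E[ H ] (part P i) ∣)) (sym (∑-constℕ (#parts P) ∣E∣)) ⟩
        ℕ∑.sum (λ i → N * ∣ E[ H ] (part P i) ∣) + ℕ∑.sum {#parts P} (λ _ → ∣E∣)
          ≡⟨ ℕ∑.∑-distrib-+ (λ i → N * ∣ E[ H ] (part P i) ∣) (λ _ → ∣E∣) ⟨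
        ℕ∑.sum (λ i → N * ∣ E[ H ] (part P i) ∣ + ∣E∣)
          ≤⟨ ∑-mono (λ i → balanced (part P i) (nonempty P i)) ⟩
        ℕ∑.sum (λ i → ∣E∣ * ∣ part P i ∣)
          ≡⟨ ℕ∑.*-distribˡ-sum ∣E∣ (λ i → ∣ part P i ∣) ⟨
        ∣E∣ * ℕ∑.sum (λ i → ∣ part P i ∣)                              ≤⟨ ℕ.*-monoʳ-≤ ∣E∣ (parts-≤ P) ⟩
        ∣E∣ * ∣V∣                                                     ∎

      bound : #parts P * ∣E∣ ≤ D * N + ∣E∣
      bound = ℕ.+-cancelˡ-≤ (N * ∣E∣) _ _ (begin
        N * ∣E∣ + #parts P * ∣E∣            ≤⟨ ℕ.+-monoˡ-≤ _ (ℕ.*-monoʳ-≤ N (∣E∣≤δ+∑E[part] P)) ⟩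
        N * (D + Σₑ) + #parts P * ∣E∣       ≡⟨ rearrange N D Σₑ _ ⟩
        D * N + (N * Σₑ + #parts P * ∣E∣)   ≤⟨ ℕ.+-monoʳ-≤ (D * N) ∑-balanced ⟩
        D * N + ∣E∣ * ∣V∣                   ≡⟨ cong (λ v → D * N + ∣E∣ * v) 1+[∣V∣∸1]≡∣V∣ ⟨
        D * N + ∣E∣ * (1 + N)               ≡⟨ rearrange′ D N ∣E∣ ⟩
        N * ∣E∣ + (D * N + ∣E∣)             ∎)
        where
        rearrange : ∀ N D Σₑ m → N * (D + Σₑ) + m ≡ D * N + (N * Σₑ + m)
        rearrange = solve-∀
        rearrange′ : ∀ D N m → D * N + m * (1 + N) ≡ N * m + (D * N + m)
        rearrange′ = solve-∀

      goal : ∣E∣ * (#parts P ∸ 1) ≤ D * N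
      goal = begin
        ∣E∣ * (#parts P ∸ 1)           ≡⟨ ℕ.*-distribˡ-∸ ∣E∣ (#parts P) 1 ⟩
        ∣E∣ * #parts P ∸ ∣E∣ * 1       ≡⟨ cong₂ _∸_ (ℕ.*-comm ∣E∣ _) (ℕ.*-identityʳ ∣E∣) ⟩
        #parts P * ∣E∣ ∸ ∣E∣           ≤⟨ ℕ.∸-monoˡ-≤ ∣E∣ bound ⟩
        D * N + ∣E∣ ∸ ∣E∣              ≡⟨ ℕ.m+n∸n≡m (D * N) ∣E∣ ⟩
        D * N                          ∎

    -- The common value is ∣E∣ / (∣V∣ - 1). The strength attains it at the singletons, which every
    -- hyperedge crosses because it has two vertices, and the arboricity attains it at X = V.
    balanced⇒strength≡arboricity : 2 ≤ ∣V∣ → Balanced → ∃[ r ] IsStrength H r × IsFractionalArboricity H r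
    balanced⇒strength≡arboricity 2≤∣V∣ balanced = ratio ∣E∣ ∣V∣ 2≤∣V∣
      , ((singletons , 2≤∣V∣ , ratio-cong 2≤∣V∣ 2≤∣V∣ (sym ∣δ-singletons∣) refl)
        , λ { q (P , 2≤P , refl) → ratio-mono 2≤∣V∣ 2≤P (balanced⇒δ balanced P) })
      , ((⊤ , 2≤∣⊤∣ , ratio-cong 2≤∣V∣ 2≤∣⊤∣ (sym ∣E[⊤]∣) (sym (Subset.∣⊤∣≡n ∣V∣)))
        , λ { q (X , 2≤X , refl) → ratio-mono 2≤X 2≤∣V∣ (bound X (1≤∣p∣⇒Nonempty (ℕ.<⇒≤ 2≤X))) })
      where
      2≤∣⊤∣ : 2 ≤ ∣ ⊤ {∣V∣} ∣
      2≤∣⊤∣ = subst (2 ≤_) (sym (Subset.∣⊤∣≡n ∣V∣)) 2≤∣V∣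
      bound : ∀ X → Nonempty X → ∣ E[ H ] X ∣ * (∣V∣ ∸ 1) ≤ ∣E∣ * (∣ X ∣ ∸ 1)
      bound X ne = begin
        ∣ E[ H ] X ∣ * (∣V∣ ∸ 1)                  ≡⟨ ℕ.*-comm ∣ E[ H ] X ∣ _ ⟩
        (∣V∣ ∸ 1) * ∣ E[ H ] X ∣                  ≡⟨ ℕ.m+n∸n≡m _ ∣E∣ ⟨
        (∣V∣ ∸ 1) * ∣ E[ H ] X ∣ + ∣E∣ ∸ ∣E∣      ≤⟨ ℕ.∸-monoˡ-≤ ∣E∣ (balanced X ne) ⟩
        ∣E∣ * ∣ X ∣ ∸ ∣E∣                         ≡⟨ cong (∣E∣ * ∣ X ∣ ∸_) (ℕ.*-identityʳ ∣E∣) ⟨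
        ∣E∣ * ∣ X ∣ ∸ ∣E∣ * 1                     ≡⟨ ℕ.*-distribˡ-∸ ∣E∣ ∣ X ∣ 1 ⟨
        ∣E∣ * (∣ X ∣ ∸ 1)                         ∎
        where open ℕ.≤-Reasoning

    -- The singletons bound the strength above by ∣E∣ / (∣V∣ - 1). If the arboricity equals it, that
    -- bound passes to every X with two vertices; a one-vertex X contains no hyperedge.
    strength≡arboricity⇒balanced : 2 ≤ ∣V∣ → ∃[ r ] IsStrength H r × IsFractionalArboricity H r → Balanced
    strength≡arboricity⇒balanced 2≤∣V∣ (r , (_ , minimum) , (_ , maximum)) X ne with ∣ X ∣ ℕ.<? 2
    ... | yes ∣X∣<2 = begin
      (∣V∣ ∸ 1) * ∣ E[ H ] X ∣ + ∣E∣   ≡⟨ cong (λ a → (∣V∣ ∸ 1) * a + ∣E∣) (trans (∣E[X]∣≡∑ X)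
      (∑-indicator-none (λ e → edge e ⊆? X) λ e e⊆X → ℕ.<⇒≱ ∣X∣<2 (edge⊆⇒2≤ {X} {e} e⊆X))) ⟩
      (∣V∣ ∸ 1) * 0 + ∣E∣              ≡⟨ cong (_+ ∣E∣) (ℕ.*-zeroʳ (∣V∣ ∸ 1)) ⟩
      ∣E∣                              ≡⟨ ℕ.*-identityʳ ∣E∣ ⟨
      ∣E∣ * 1                          ≤⟨ ℕ.*-monoʳ-≤ ∣E∣ (Nonempty⇒1≤∣p∣ ne) ⟩
      ∣E∣ * ∣ X ∣                      ∎
      where open ℕ.≤-Reasoning
    ... | no ∣X∣≮2 = begin
      (∣V∣ ∸ 1) * ∣ E[ H ] X ∣ + ∣E∣    ≡⟨ cong (_+ ∣E∣) (ℕ.*-comm (∣V∣ ∸ 1) _) ⟩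
      ∣ E[ H ] X ∣ * (∣V∣ ∸ 1) + ∣E∣    ≤⟨ ℕ.+-monoˡ-≤ ∣E∣ (ratio-cancel 2≤X 2≤∣V∣
                                            (ℚ.≤-trans (maximum _ (X , 2≤X , refl)) (minimum _
      (singletons , 2≤∣V∣ , ratio-cong 2≤∣V∣ 2≤∣V∣ (sym ∣δ-singletons∣) refl)))) ⟩
      ∣E∣ * (∣ X ∣ ∸ 1) + ∣E∣           ≡⟨ cong (∣E∣ * (∣ X ∣ ∸ 1) +_) (ℕ.*-identityʳ ∣E∣) ⟨
      ∣E∣ * (∣ X ∣ ∸ 1) + ∣E∣ * 1       ≡⟨ ℕ.*-distribˡ-+ ∣E∣ (∣ X ∣ ∸ 1) 1 ⟨
      ∣E∣ * (∣ X ∣ ∸ 1 + 1)             ≡⟨ cong (∣E∣ *_) (ℕ.m∸n+n≡m (ℕ.≤-trans (s≤s z≤n) 2≤X)) ⟩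
      ∣E∣ * ∣ X ∣                       ∎
      where
      open ℕ.≤-Reasoning
      2≤X : 2 ≤ ∣ X ∣
      2≤X = ℕ.≮⇒≥ ∣X∣≮2

  -- Growing hyperforests by merging vertex labels.

  module _ (H : Hypergraph) where
    open Hypergraph H

    bump : Multiset H → Fin ∣E∣ → Multiset H
    bump A e e′ = A e′ + indicator (e Fin.≟ e′)

    size-bump : ∀ A e → size H (bump A e) ≡ size H A + 1
    size-bump A e =
      trans (ℕ∑.∑-distrib-+ A (λ e′ → indicator (e Fin.≟ e′))) (cong (size H A +_) (∑-indicator-≡1 e))

    private
      if-+ : ∀ b x y → (if b then x + y else 0) ≡ (if b then x else 0) + (if b then y else 0)
      if-+ true  x y = refl
      if-+ false x y = refl

    sizeIn-bump : ∀ A e X → sizeIn H (bump A e) X ≡ sizeIn H A X + indicator (edge e ⊆? X)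
    sizeIn-bump A e X = begin
      sizeIn H (bump A e) X
        ≡⟨ ℕ∑.sum-cong-≗ (λ e′ → if-+ (does (edge e′ ⊆? X)) (A e′) _) ⟩
      ℕ∑.sum (λ e′ → inX e′ (A e′) + inX e′ (indicator (e Fin.≟ e′)))
        ≡⟨ ℕ∑.∑-distrib-+ (λ e′ → inX e′ (A e′)) (λ e′ → inX e′ (indicator (e Fin.≟ e′))) ⟩
      sizeIn H A X + ℕ∑.sum (λ e′ → inX e′ (indicator (e Fin.≟ e′)))
        ≡⟨ cong (sizeIn H A X +_) single ⟩
      sizeIn H A X + indicator (edge e ⊆? X)                    ∎
      where
      open ≡.≡-Reasoning
      inX : Fin ∣E∣ → ℕ → ℕ
      inX e′ a = if does (edge e′ ⊆? X) then a else 0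

      pointwise : ∀ e′ → inX e′ (indicator (e Fin.≟ e′)) ≡ indicator (edge e ⊆? X) * indicator (e Fin.≟ e′)
      pointwise e′ with e Fin.≟ e′
      ... | yes refl = sym (ℕ.*-identityʳ _)
      ... | no  _    = trans (Bool.if-eta (does (edge e′ ⊆? X))) (sym (ℕ.*-zeroʳ (indicator (edge e ⊆? X))))

      single : ℕ∑.sum (λ e′ → inX e′ (indicator (e Fin.≟ e′))) ≡ indicator (edge e ⊆? X)
      single = trans (ℕ∑.sum-cong-≗ pointwise)
        (trans (sym (ℕ∑.*-distribˡ-sum (indicator (edge e ⊆? X)) (λ e′ → indicator (e Fin.≟ e′))))
        (trans (cong (indicator (edge e ⊆? X) *_) (∑-indicator-≡1 e)) (ℕ.*-identityʳ _)))

    -- A partition of V, given by labelling every vertex with the name of its part.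
    Labelling : Set
    Labelling = Fin ∣V∣ → Fin ∣V∣

    Occurs : Labelling → Subset ∣V∣ → Fin ∣V∣ → Set
    Occurs ℓ X l = ∃[ v ] v ∈ X × ℓ v ≡ l

    occurs? : ∀ ℓ X l → Dec (Occurs ℓ X l)
    occurs? ℓ X l = Fin.any? λ v → (v ∈? X) ×-dec (ℓ v Fin.≟ l)

    #labels : Labelling → Subset ∣V∣ → ℕ
    #labels ℓ X = ℕ∑.sum λ l → indicator (occurs? ℓ X l)

    -- ℓ describes the components of a hyperforest A obtained by replacing
    -- hyperedges with edges of a forest on V.
    record IsForest (ℓ : Labelling) (A : Multiset H) : Set where
      field
        sparse : ∀ X → sizeIn H A X + #labels ℓ X ≤ ∣ X ∣
        total  : ∣V∣ ≤ size H A + #labels ℓ ⊤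

    discrete-forest : IsForest (λ v → v) (λ _ → 0)
    discrete-forest = record
      { sparse = λ X → ℕ.≤-reflexive (trans (cong₂ _+_ (sizeIn-∅ X) (labels X)) (sym (∣p∣≡∑ X)))
      ; total  = ℕ.≤-trans (ℕ.≤-reflexive (trans (sym (Subset.∣⊤∣≡n ∣V∣)) (trans (∣p∣≡∑ {∣V∣} ⊤) (sym (labels ⊤)))))
                           (ℕ.m≤n+m _ (size H (λ _ → 0)))
      }
      where
      sizeIn-∅ : ∀ X → sizeIn H (λ _ → 0) X ≡ 0
      sizeIn-∅ X = trans (ℕ∑.sum-cong-≗ λ e → Bool.if-eta (does (edge e ⊆? X))) (ℕ∑.sum-replicate-zero ∣E∣)
      labels : ∀ X → #labels (λ v → v) X ≡ ℕ∑.sum (λ v → indicator (v ∈? X))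
      labels X = ℕ∑.sum-cong-≗ λ v → indicator-cong (occurs? (λ v → v) X v) (v ∈? X)
        (λ { (u , u∈X , refl) → u∈X }) (λ v∈X → v , v∈X , refl)

    relabel : (a b : Fin ∣V∣) → Labelling → Labelling
    relabel a b ℓ v = if does (ℓ v Fin.≟ a) then b else ℓ v

    module _ {a b : Fin ∣V∣} (ℓ : Labelling) where
      relabel-≡ : ∀ {v} → ℓ v ≡ a → relabel a b ℓ v ≡ b
      relabel-≡ {v} eq with ℓ v Fin.≟ a
      ... | yes _ = refl
      ... | no ¬p = contradiction eq ¬p

      relabel-≢ : ∀ {v} → ℓ v ≢ a → relabel a b ℓ v ≡ ℓ v
      relabel-≢ {v} neq with ℓ v Fin.≟ a
      ... | yes p = contradiction p neq
      ... | no _  = refl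

      relabel-cong : ∀ {u v} → ℓ u ≡ ℓ v → relabel a b ℓ u ≡ relabel a b ℓ v
      relabel-cong eq = cong (λ l → if does (l Fin.≟ a) then b else l) eq

      module _ (a≢b : a ≢ b) (X : Subset ∣V∣) where
        private
          occurs-relabel : ∀ {l} → l ≢ b → Occurs (relabel a b ℓ) X l → Occurs ℓ X l × l ≢ a
          occurs-relabel l≢b (v , v∈X , refl) with ℓ v Fin.≟ a
          ... | yes p = contradiction refl l≢b
          ... | no ¬p = (v , v∈X , refl) , ¬p

          occurs-relabel′ : ∀ {l} → l ≢ a → Occurs ℓ X l → Occurs (relabel a b ℓ) X l
          occurs-relabel′ l≢a (v , v∈X , refl) = v , v∈X , relabel-≢ l≢a

          ∑-+≡ : ∀ (f : Vector ℕ ∣V∣) l → ℕ∑.sum (λ l′ → f l′ + indicator (l Fin.≟ l′)) ≡ ℕ∑.sum f + 1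
          ∑-+≡ f l =
            trans (ℕ∑.∑-distrib-+ f (λ l′ → indicator (l Fin.≟ l′))) (cong (ℕ∑.sum f +_) (∑-indicator-≡1 l))

        -- The label `a` disappears, and `b` was already counted, so nothing replaces it.
        relabel-both : Occurs ℓ X a → Occurs ℓ X b → #labels (relabel a b ℓ) X + 1 ≤ #labels ℓ X
        relabel-both a∈ b∈ = ℕ.≤-trans (ℕ.≤-reflexive (sym (∑-+≡ _ a))) (∑-mono pointwise)
          where
          pointwise : ∀ l → indicator (occurs? (relabel a b ℓ) X l) + indicator (a Fin.≟ l) ≤ indicator (occurs? ℓ X l)
          pointwise l with a Fin.≟ l
          ... | yes refl = ℕ.≤-reflexive (trans (cong (_+ 1) (indicator-no (occurs? (relabel a b ℓ) X a)
                             λ o → proj₂ (occurs-relabel a≢b o) refl)) (sym (indicator-yes (occurs? ℓ X a) a∈)))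
          ... | no _ = ℕ.≤-trans (ℕ.≤-reflexive (ℕ.+-identityʳ _))
                         (indicator-mono (occurs? (relabel a b ℓ) X l) (occurs? ℓ X l) old)
            where
            old : Occurs (relabel a b ℓ) X l → Occurs ℓ X l
            old o with l Fin.≟ b
            ... | yes refl = b∈
            ... | no l≢b   = proj₁ (occurs-relabel l≢b o)

        -- If X meets `a` but not `b`, the merge trades one label for the other, and the counts do
        -- not compare label by label. The indicators of `a` and `b`, each of total 1, are added on
        -- the two sides to absorb the trade.
        relabel-≤ : #labels (relabel a b ℓ) X ≤ #labels ℓ X
        relabel-≤ with occurs? ℓ X a
        ... | no a∉ = ∑-mono λ l → indicator-mono (occurs? (relabel a b ℓ) X l) (occurs? ℓ X l)
          λ { (v , v∈X , eq) → v , v∈X , trans (sym (relabel-≢ λ p → a∉ (v , v∈X , p))) eq }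
        ... | yes a∈ = ℕ.+-cancelʳ-≤ 1 _ _ (ℕ.≤-trans (ℕ.≤-reflexive (sym (∑-+≡ _ a)))
                         (ℕ.≤-trans (∑-mono pointwise) (ℕ.≤-reflexive (∑-+≡ _ b))))
          where
          pointwise : ∀ l → indicator (occurs? (relabel a b ℓ) X l) + indicator (a Fin.≟ l)
                          ≤ indicator (occurs? ℓ X l) + indicator (b Fin.≟ l)
          pointwise l with a Fin.≟ l | b Fin.≟ l
          ... | yes refl | yes refl = contradiction refl a≢b
          ... | yes refl | no _ = ℕ.≤-trans
            (ℕ.≤-reflexive (trans (cong (_+ 1)
              (indicator-no (occurs? (relabel a b ℓ) X a) λ o → proj₂ (occurs-relabel a≢b o) refl))
                                  (sym (indicator-yes (occurs? ℓ X a) a∈)))) (ℕ.m≤m+n _ 0)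
          ... | no _ | yes refl = ℕ.≤-trans (ℕ.≤-reflexive (ℕ.+-identityʳ _))
            (ℕ.≤-trans (indicator-≤1 (occurs? (relabel a b ℓ) X b)) (ℕ.m≤n+m 1 _))
          ... | no _ | no b≢l = ℕ.+-monoˡ-≤ 0 (indicator-mono (occurs? (relabel a b ℓ) X l) (occurs? ℓ X l)
                                  (λ o → proj₁ (occurs-relabel (b≢l ∘ sym) o)))

        relabel-≥ : #labels ℓ X ≤ #labels (relabel a b ℓ) X + 1
        relabel-≥ = ℕ.≤-trans (∑-mono pointwise) (ℕ.≤-reflexive (∑-+≡ _ a))
          where
          pointwise : ∀ l → indicator (occurs? ℓ X l) ≤ indicator (occurs? (relabel a b ℓ) X l) + indicator (a Fin.≟ l)
          pointwise l with a Fin.≟ l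
          ... | yes refl = ℕ.≤-trans (indicator-≤1 (occurs? ℓ X a)) (ℕ.m≤n+m 1 _)
          ... | no a≢l   = ℕ.≤-trans
            (indicator-mono (occurs? ℓ X l) (occurs? (relabel a b ℓ) X l) (occurs-relabel′ (a≢l ∘ sym)))
                             (ℕ.m≤m+n _ 0)

    -- The new copy of `e` acts as the graph edge uv. An X that contains `e` meets both labels, so
    -- the label lost there pays for the copy; on any other X merging does not raise the count. On
    -- all of V at most one label is lost, which preserves `total`.
    bump-forest : ∀ {ℓ A e u v} → IsForest ℓ A → u ∈ edge e → v ∈ edge e → ℓ u ≢ ℓ v →
      IsForest (relabel (ℓ u) (ℓ v) ℓ) (bump A e)
    bump-forest {ℓ} {A} {e} {u} {v} forest u∈e v∈e u≢v = record { sparse = sparse′ ; total = total′ }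
      where
      open IsForest forest
      open ℕ.≤-Reasoning
      ℓ′ : Labelling
      ℓ′ = relabel (ℓ u) (ℓ v) ℓ

      sparse′ : ∀ X → sizeIn H (bump A e) X + #labels ℓ′ X ≤ ∣ X ∣
      sparse′ X = begin
        sizeIn H (bump A e) X + #labels ℓ′ X
          ≡⟨ cong (_+ #labels ℓ′ X) (sizeIn-bump A e X) ⟩
        sizeIn H A X + indicator (edge e ⊆? X) + #labels ℓ′ X   ≡⟨ ℕ.+-assoc (sizeIn H A X) _ _ ⟩
        sizeIn H A X + (indicator (edge e ⊆? X) + #labels ℓ′ X)
          ≤⟨ ℕ.+-monoʳ-≤ (sizeIn H A X) (drop (edge e ⊆? X)) ⟩
        sizeIn H A X + #labels ℓ X                              ≤⟨ sparse X ⟩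
        ∣ X ∣                                                   ∎
        where
        drop : (d : Dec (edge e ⊆ X)) → indicator d + #labels ℓ′ X ≤ #labels ℓ X
        drop (yes e⊆X) = ℕ.≤-trans (ℕ.≤-reflexive (ℕ.+-comm 1 _))
          (relabel-both ℓ u≢v X (u , e⊆X u∈e , refl) (v , e⊆X v∈e , refl))
        drop (no _)    = relabel-≤ ℓ u≢v X

      total′ : ∣V∣ ≤ size H (bump A e) + #labels ℓ′ ⊤
      total′ = begin
        ∣V∣                                  ≤⟨ total ⟩
        size H A + #labels ℓ ⊤               ≤⟨ ℕ.+-monoʳ-≤ (size H A) (relabel-≥ ℓ u≢v ⊤) ⟩
        size H A + (#labels ℓ′ ⊤ + 1)        ≡⟨ cong (size H A +_) (ℕ.+-comm _ 1) ⟩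
        size H A + (1 + #labels ℓ′ ⊤)        ≡⟨ ℕ.+-assoc (size H A) 1 _ ⟨
        size H A + 1 + #labels ℓ′ ⊤          ≡⟨ cong (_+ #labels ℓ′ ⊤) (size-bump A e) ⟨
        size H (bump A e) + #labels ℓ′ ⊤     ∎

    -- The outcome of adding to (ℓ , A) as many copies of e as possible.
    record Extension (ℓ : Labelling) (A : Multiset H) (e : Fin ∣E∣) (vs : List (Fin ∣V∣)) (r : Fin ∣V∣) : Set where
      field
        label    : Labelling
        forest   : Multiset H
        isForest : IsForest label forest
        coarser  : ∀ {u v} → ℓ u ≡ ℓ v → label u ≡ label v
        copies   : ℕ
        adds     : ∀ e′ → forest e′ ≡ A e′ + copies * indicator (e Fin.≟ e′)
        joined   : ∀ {v} → v ∈ᴸ vs → v ∈ edge e → label v ≡ label r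

    -- Each listed vertex of `e` still separated from the root `r` costs one copy of `e` and is
    -- merged into the class of `r`. Later merges only coarsen the labelling, so vertices joined
    -- once stay joined.
    extend : ∀ ℓ A → IsForest ℓ A → ∀ e vs {r} → r ∈ edge e → Extension ℓ A e vs r
    extend ℓ A isF e [] r∈e = record
      { label = ℓ ; forest = A ; isForest = isF ; coarser = λ eq → eq
      ; copies = 0 ; adds = λ e′ → sym (ℕ.+-identityʳ _) ; joined = λ ()
      }
    extend ℓ A isF e (w ∷ vs) {r} r∈e with w ∈? edge e | ℓ w Fin.≟ ℓ r
    ... | no w∉e | _ = record
      { label = label ; forest = forest ; isForest = isForest ; coarser = coarser ; copies = copies ; adds = adds
      ; joined = λ { (here refl) w∈e → contradiction w∈e w∉e ; (there v∈vs) → joined v∈vs }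
      }
      where open Extension (extend ℓ A isF e vs {r} r∈e)
    ... | yes _ | yes w≡r = record
      { label = label ; forest = forest ; isForest = isForest ; coarser = coarser ; copies = copies ; adds = adds
      ; joined = λ { (here refl) _ → coarser w≡r ; (there v∈vs) → joined v∈vs }
      }
      where open Extension (extend ℓ A isF e vs {r} r∈e)
    ... | yes w∈e | no w≢r = record
      { label = label ; forest = forest ; isForest = isForest
      ; coarser = λ eq → coarser (relabel-cong ℓ eq)
      ; copies = suc copies
      ; adds = λ e′ → trans (adds e′) (ℕ.+-assoc (A e′) _ _)
      ; joined = λ { (here refl) _ → coarser (trans (relabel-≡ ℓ refl) (sym (relabel-≢ ℓ (w≢r ∘ sym))))
                   ; (there v∈vs) → joined v∈vs }
      }
      where open Extension (extend (relabel (ℓ w) (ℓ r) ℓ) (bump A e) (bump-forest isF w∈e r∈e w≢r) e vs {r} r∈e)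

    Joined : Labelling → Fin ∣E∣ → Set
    Joined ℓ e = ∀ {u v} → u ∈ edge e → v ∈ edge e → ℓ u ≡ ℓ v

    class : Labelling → Fin ∣V∣ → Subset ∣V∣
    class ℓ l = tabulate λ v → does (ℓ v Fin.≟ l)

    -- Each hyperedge of `F` lies in a single class. Summing `Balanced` over the classes that occur
    -- gives N ∣F∣ ≤ ∣E∣ (∣V∣ - #labels), and `total` bounds the bracket by the size of `A`. Labels
    -- that do not occur have an empty class, which contributes nothing. This is the nonnegativity
    -- of the partial sums in the Abel summation.
    balanced⇒joined-≤ : Balanced H → ∀ {ℓ A} → IsForest ℓ A → ∀ (F : Subset ∣E∣) → (∀ e → e ∈ F → Joined ℓ e) →
      (∣V∣ ∸ 1) * ∣ F ∣ ≤ ∣E∣ * size H A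
    balanced⇒joined-≤ balanced {ℓ} {A} forest F joined = ℕ.+-cancelʳ-≤ (∣E∣ * #labels ℓ ⊤) _ _ (begin
      N * ∣ F ∣ + ∣E∣ * #labels ℓ ⊤              ≤⟨ ℕ.+-monoˡ-≤ _ (ℕ.*-monoʳ-≤ N F≤) ⟩
      N * ℕ∑.sum inside + ∣E∣ * #labels ℓ ⊤
        ≡⟨ cong₂ _+_ (ℕ∑.*-distribˡ-sum N inside) (ℕ∑.*-distribˡ-sum ∣E∣ used) ⟩
      ℕ∑.sum (λ l → N * inside l) + ℕ∑.sum (λ l → ∣E∣ * used l)
        ≡⟨ ℕ∑.∑-distrib-+ (λ l → N * inside l) (λ l → ∣E∣ * used l) ⟨
      ℕ∑.sum (λ l → N * inside l + ∣E∣ * used l) ≤⟨ ∑-mono pointwise ⟩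
      ℕ∑.sum (λ l → ∣E∣ * ∣ class ℓ l ∣)         ≡⟨ ℕ∑.*-distribˡ-sum ∣E∣ (λ l → ∣ class ℓ l ∣) ⟨
      ∣E∣ * ℕ∑.sum (λ l → ∣ class ℓ l ∣)         ≡⟨ cong (∣E∣ *_) ∑-classes ⟩
      ∣E∣ * ∣V∣                                  ≤⟨ ℕ.*-monoʳ-≤ ∣E∣ total ⟩
      ∣E∣ * (size H A + #labels ℓ ⊤)             ≡⟨ ℕ.*-distribˡ-+ ∣E∣ (size H A) _ ⟩
      ∣E∣ * size H A + ∣E∣ * #labels ℓ ⊤         ∎)
      where
      open ℕ.≤-Reasoning
      open IsForest forest
      N : ℕ
      N = ∣V∣ ∸ 1
      inside used : Vector ℕ ∣V∣
      inside l = ∣ E[ H ] (class ℓ l) ∣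
      used   l = indicator (occurs? ℓ ⊤ l)

      ∑-classes : ℕ∑.sum (λ l → ∣ class ℓ l ∣) ≡ ∣V∣
      ∑-classes = begin-equality
        ℕ∑.sum (λ l → ∣ class ℓ l ∣)
          ≡⟨ ℕ∑.sum-cong-≗ (λ l → ∣tabulate∣≡∑ (λ v → ℓ v Fin.≟ l)) ⟩
        ℕ∑.sum (λ l → ℕ∑.sum λ v → indicator (ℓ v Fin.≟ l))
          ≡⟨ ℕ∑.∑-comm (λ l v → indicator (ℓ v Fin.≟ l)) ⟩
        ℕ∑.sum (λ v → ℕ∑.sum λ l → indicator (ℓ v Fin.≟ l))    ≡⟨ ℕ∑.sum-cong-≗ (λ v → ∑-indicator-≡1 (ℓ v)) ⟩
        ℕ∑.sum {∣V∣} (λ _ → 1)                                 ≡⟨ trans (∑-constℕ ∣V∣ 1) (ℕ.*-identityʳ ∣V∣) ⟩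
        ∣V∣                                                    ∎

      pointwise : ∀ l → N * inside l + ∣E∣ * used l ≤ ∣E∣ * ∣ class ℓ l ∣
      pointwise l with occurs? ℓ ⊤ l
      ... | yes (v , _ , ℓv≡l) = ℕ.≤-trans (ℕ.≤-reflexive (cong (N * inside l +_) (ℕ.*-identityʳ ∣E∣)))
        (balanced (class ℓ l) (v , ∈-tabulate⁺ (λ v → ℓ v Fin.≟ l) ℓv≡l))
      ... | no none = ℕ.≤-trans (ℕ.≤-reflexive (cong₂ _+_ (trans (cong (N *_) empty) (ℕ.*-zeroʳ N)) (ℕ.*-zeroʳ ∣E∣))) z≤n
        where
        empty : inside l ≡ 0
        empty = trans (∣E[X]∣≡∑ H (class ℓ l)) (∑-indicator-none (λ e → edge e ⊆? class ℓ l) λ e e⊆ →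
          case edge-nonempty H e of λ (v , v∈e) → none (v , Subset.∈⊤ , ∈-tabulate⁻ (λ v → ℓ v Fin.≟ l) (e⊆ v∈e)))

      F≤ : ∣ F ∣ ≤ ℕ∑.sum inside
      F≤ = begin
        ∣ F ∣                                                            ≡⟨ ∣p∣≡∑ F ⟩
        ℕ∑.sum (λ e → indicator (e ∈? F))                               ≤⟨ ∑-mono covered ⟩
        ℕ∑.sum (λ e → ℕ∑.sum λ l → indicator (edge e ⊆? class ℓ l))
          ≡⟨ ℕ∑.∑-comm (λ e l → indicator (edge e ⊆? class ℓ l)) ⟩
        ℕ∑.sum (λ l → ℕ∑.sum λ e → indicator (edge e ⊆? class ℓ l))
          ≡⟨ ℕ∑.sum-cong-≗ (λ l → ∣E[X]∣≡∑ H (class ℓ l)) ⟨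
        ℕ∑.sum inside                                                   ∎
        where
        covered : ∀ e → indicator (e ∈? F) ≤ ℕ∑.sum λ l → indicator (edge e ⊆? class ℓ l)
        covered e with e ∈? F
        ... | no _ = z≤n
        ... | yes e∈F with r , r∈e ← edge-nonempty H e =
          ∑-indicator-≥1 (λ l → edge e ⊆? class ℓ l) (ℓ r)
            λ v∈e → ∈-tabulate⁺ (λ v → ℓ v Fin.≟ ℓ r) (joined e e∈F v∈e r∈e)

    #labels-≥1 : ∀ {ℓ X} → Nonempty X → 1 ≤ #labels ℓ X
    #labels-≥1 {ℓ} {X} (v , v∈X) = ∑-indicator-≥1 (occurs? ℓ X) (ℓ v) (v , v∈X , refl)

    -- A nonempty X meets at least one label; that label accounts for the 1 subtracted from ∣X∣.
    forest⇒hyperforest : ∀ {ℓ A} → IsForest ℓ A → IsHyperforest H A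
    forest⇒hyperforest {ℓ} {A} forest X ne = begin
      sizeIn H A X                             ≤⟨ ℕ.m≤m+n _ _ ⟩
      sizeIn H A X + (#labels ℓ X ∸ 1)         ≡⟨ ℕ.+-∸-assoc (sizeIn H A X) (#labels-≥1 {ℓ} {X} ne) ⟨
      sizeIn H A X + #labels ℓ X ∸ 1           ≤⟨ ℕ.∸-monoˡ-≤ 1 (IsForest.sparse forest X) ⟩
      ∣ X ∣ ∸ 1                                ∎
      where open ℕ.≤-Reasoning

    sizeIn-⊤ : ∀ A → sizeIn H A ⊤ ≡ size H A
    sizeIn-⊤ A =
      ℕ∑.sum-cong-≗ λ e → cong (λ b → if b then A e else 0) (dec-true (edge e ⊆? ⊤) (Subset.⊆-max (edge e)))

    forest⇒size-≤ : ∀ {ℓ A} → IsForest ℓ A → size H A ≤ ∣V∣ ∸ 1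
    forest⇒size-≤ {ℓ} {A} forest = begin
      size H A             ≡⟨ sizeIn-⊤ A ⟨
      sizeIn H A ⊤
        ≤⟨ forest⇒hyperforest forest ⊤ (1≤∣p∣⇒Nonempty (subst (1 ≤_) (sym (Subset.∣⊤∣≡n ∣V∣)) 1≤∣V∣)) ⟩
      ∣ ⊤ {∣V∣} ∣ ∸ 1      ≡⟨ cong (_∸ 1) (Subset.∣⊤∣≡n ∣V∣) ⟩
      ∣V∣ ∸ 1              ∎
      where
      open ℕ.≤-Reasoning
      1≤∣V∣ : 1 ≤ ∣V∣
      1≤∣V∣ = subst (1 ≤_) (1+[∣V∣∸1]≡∣V∣ H) (s≤s z≤n)

    -- If `v` were missed, all ∣V∣ - 1 members would lie in the complement of `v`, a nonempty set of
    -- ∣V∣ - 1 vertices that can hold only ∣V∣ - 2 of them.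
    hyperforest⇒spanning : 2 ≤ ∣V∣ → ∀ {A} → IsHyperforest H A → size H A ≡ ∣V∣ ∸ 1 → IsSpanningHypertree H A
    hyperforest⇒spanning 2≤∣V∣ {A} hyperforest size≡ =
      record { spanning = spanning ; hyperforest = hyperforest ; size≡∣V∣-1 = size≡ }
      where
      1≤N : 1 ≤ ∣V∣ ∸ 1
      1≤N = ℕ.∸-monoˡ-≤ 1 2≤∣V∣

      spanning : ∀ v → ∃[ e ] 0 < A e × v ∈ edge e
      spanning v with Fin.any? (λ e → (0 ℕ.<? A e) ×-dec (v ∈? edge e))
      ... | yes found = found
      ... | no none = contradiction too-large (ℕ.<⇒≱ (ℕ.∸-monoʳ-< (s≤s z≤n) 1≤N))
        where
        X : Subset ∣V∣
        X = ∁ ⁅ v ⁆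

        ∣X∣≡ : ∣ X ∣ ≡ ∣V∣ ∸ 1
        ∣X∣≡ = trans (Subset.∣∁p∣≡n∸∣p∣ ⁅ v ⁆) (cong (∣V∣ ∸_) (Subset.∣⁅x⁆∣≡1 v))

        avoids : ∀ e → v ∉ edge e → edge e ⊆ X
        avoids e v∉e {u} u∈e =
          Subset.x∉p⇒x∈∁p λ u∈⁅v⁆ → v∉e (subst (_∈ edge e) (Subset.x∈⁅y⁆⇒x≡y v u∈⁅v⁆) u∈e)

        all-in-X : ∀ e → (if does (edge e ⊆? X) then A e else 0) ≡ A e
        all-in-X e with A e in eq | v ∈? edge e
        ... | 0     | _ = Bool.if-eta (does (edge e ⊆? X))
        ... | suc k | yes v∈e = contradiction (e , subst (0 <_) (sym eq) (s≤s z≤n) , v∈e) none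
        ... | suc k | no v∉e  = cong (λ b → if b then suc k else 0) (dec-true (edge e ⊆? X) (avoids e v∉e))

        too-large : ∣V∣ ∸ 1 ≤ ∣V∣ ∸ 1 ∸ 1
        too-large = begin
          ∣V∣ ∸ 1          ≡⟨ size≡ ⟨
          size H A         ≡⟨ ℕ∑.sum-cong-≗ all-in-X ⟨
          sizeIn H A X     ≤⟨ hyperforest X (1≤∣p∣⇒Nonempty (subst (1 ≤_) (sym ∣X∣≡) 1≤N)) ⟩
          ∣ X ∣ ∸ 1        ≡⟨ cong (_∸ 1) ∣X∣≡ ⟩
          ∣V∣ ∸ 1 ∸ 1      ∎
          where open ℕ.≤-Reasoning

-- Pairings of densities with multisets, and the greedy bound.

module HypertreeModulus {c ℓ₁ ℓ₂} (ℝ : RealNumbers c ℓ₁ ℓ₂) (H : Hypergraph) where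
  open RealNumbers ℝ hiding (zero; complete)
  open RealProperties ℝ
  open LinearMinimum ℝ
  open Modulus ℝ
  open Counting
  open Hypergraph H

  private
    N : ℕ
    N = ∣V∣ ℕ.∸ 1

  fromℕ-∑ : ∀ {n} (f : Vector ℕ n) → fromℕ (ℕ∑.sum f) ≈ sum (fromℕ ∘ f)
  fromℕ-∑ {zero}  f = refl
  fromℕ-∑ {suc n} f = trans (fromℕ-+ (f zero) _) (+-congˡ (fromℕ-∑ (f ∘ suc)))

  weight : Multiset H → Vector Carrier ∣E∣ → Carrier
  weight A ρ = sum λ e → fromℕ (A e) * ρ e

  weight-cong : ∀ {A A′} ρ → (∀ e → A e ≡ A′ e) → weight A ρ ≈ weight A′ ρ
  weight-cong ρ A≗A′ = sum-cong-≋ λ e → *-congʳ (fromℕ-cong (A≗A′ e))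

  weight-+ : ∀ A B ρ → weight (λ e → A e ℕ.+ B e) ρ ≈ weight A ρ + weight B ρ
  weight-+ A B ρ = trans (sum-cong-≋ λ e → trans (*-congʳ (fromℕ-+ (A e) (B e))) (distribʳ (ρ e) _ _))
    (∑-distrib-+ (λ e → fromℕ (A e) * ρ e) (λ e → fromℕ (B e) * ρ e))

  weight-scale : ∀ k B ρ → weight (λ e → k ℕ.* B e) ρ ≈ fromℕ k * weight B ρ
  weight-scale k B ρ = trans (sum-cong-≋ λ e → trans (*-congʳ (fromℕ-* k (B e))) (*-assoc _ _ _))
    (sym (*-distribˡ-sum (fromℕ k) (λ e → fromℕ (B e) * ρ e)))

  weight-none : ∀ {A} ρ → (∀ e → A e ≡ 0) → weight A ρ ≈ 0#
  weight-none {A} ρ A≗0 = trans (weight-cong ρ A≗0) (trans (weight-scale 0 A ρ) (zeroˡ _))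

  weight-const : ∀ A x → weight A (λ _ → x) ≈ fromℕ (size H A) * x
  weight-const A x =
    trans (sum-cong-≋ λ e → *-comm (fromℕ (A e)) x) (trans (sym (*-distribˡ-sum x (fromℕ ∘ A)))
    (trans (*-comm x _) (*-congʳ (sym (fromℕ-∑ A)))))

  weight-single : ∀ e ρ → weight (λ e′ → indicator (e Fin.≟ e′)) ρ ≈ ρ e
  weight-single e ρ = trans (sum-cong-≋ pointwise) (trans (weight-const (λ e′ → indicator (e Fin.≟ e′)) (ρ e))
    (trans (*-congʳ (trans (fromℕ-cong (∑-indicator-≡1 e)) fromℕ-1)) (*-identityˡ _)))
    where
    pointwise : ∀ e′ → fromℕ (indicator (e Fin.≟ e′)) * ρ e′ ≈ fromℕ (indicator (e Fin.≟ e′)) * ρ e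
    pointwise e′ with e Fin.≟ e′
    ... | yes ≡.refl = refl
    ... | no _       = trans (zeroˡ _) (sym (zeroˡ _))

  adm⇒1≤weight : ∀ {A ρ} → IsSpanningHypertree H A → Adm (Ω H) ρ → 1# ≤ weight A ρ
  adm⇒1≤weight hypertree (_ , adm) = adm _ (_ , hypertree , λ _ → refl)

  members : Subset ∣E∣ → Multiset H
  members F e = indicator (e ∈? F)

  members-insert : ∀ F {e} → e ∉ F → ∀ e′ → members (F ∪ ⁅ e ⁆) e′ ≡ members F e′ ℕ.+ indicator (e Fin.≟ e′)
  members-insert F {e} e∉F e′ with e Fin.≟ e′
  ... | yes ≡.refl = ≡.trans (indicator-yes (e ∈? F ∪ ⁅ e ⁆) (Subset.q⊆p∪q F _ (Subset.x∈⁅x⁆ e)))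
                             (≡.cong (ℕ._+ 1) (≡.sym (indicator-no (e ∈? F) e∉F)))
  ... | no e≢e′ = ≡.trans (indicator-cong (e′ ∈? F ∪ ⁅ e ⁆) (e′ ∈? F)
      (λ e′∈ → [ (λ e′∈F → e′∈F)
               , (λ e′∈⁅e⁆ → contradiction (≡.sym (Subset.x∈⁅y⁆⇒x≡y e e′∈⁅e⁆)) e≢e′) ]′ (Subset.x∈p∪q⁻ F _ e′∈))
      (Subset.p⊆p∪q _)) (≡.sym (ℕ.+-identityʳ _))

  ∣F∪⁅e⁆∣ : ∀ F {e} → e ∉ F → ∣ F ∪ ⁅ e ⁆ ∣ ≡ ∣ F ∣ ℕ.+ 1
  ∣F∪⁅e⁆∣ F {e} e∉F = ≡.trans (∣p∣≡∑ (F ∪ ⁅ e ⁆)) (≡.trans (ℕ∑.sum-cong-≗ (members-insert F e∉F))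
    (≡.trans (size-bump H (members F) e) (≡.cong (ℕ._+ 1) (≡.sym (∣p∣≡∑ F)))))

  -- Kruskal's algorithm run through the hyperedges by increasing ρ yields a
  -- hypertree A; the bound is Abel summation of (∣E∣ A - (∣V∣ - 1) 1) · ρ, all of
  -- whose partial sums of coefficients are nonnegative.
  balanced⇒∣E∣≤ : 2 ℕ.≤ ∣V∣ → 1 ℕ.≤ ∣E∣ → Balanced H → ∀ {ρ} → Adm (Ω H) ρ → fromℕ ∣E∣ ≤ fromℕ N * sum ρ
  balanced⇒∣E∣≤ 2≤∣V∣ 1≤∣E∣ balanced {ρ} adm =
    go Data.Fin.Subset.⊥ (⊃-wellFounded _) record
      { isForest = discrete-forest H
      ; joined = λ e e∈⊥ → contradiction e∈⊥ Subset.∉⊥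
      ; lower = λ e _ → proj₁ adm e
      ; abel = ≤-reflexive (trans (vanishes (weight-none ρ λ _ → ≡.refl))
          (sym (vanishes (weight-none ρ λ e → indicator-no (e ∈? Data.Fin.Subset.⊥) Subset.∉⊥))))
      }
    where
    open ≤-Reasoning
    M′ N′ : Carrier
    M′ = fromℕ ∣E∣
    N′ = fromℕ N

    vanishes : ∀ {x y z} → y ≈ 0# → x * y + z * 0# ≈ 0#
    vanishes y≈0 = trans (+-cong (trans (*-congˡ y≈0) (zeroʳ _)) (zeroʳ _)) (+-identityˡ 0#)

    -- `F` holds the hyperedges processed so far, and `bound` is the current threshold b, initially
    -- 0. Written without subtraction, `abel` says that the sum over e of (∣E∣ A(e) - N 1_F(e))
    -- (ρ(e) - b) is at most 0, where A is `forest`.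
    record State (F : Subset ∣E∣) : Set (c ⊔ ℓ₂) where
      field
        {label}  : Labelling H
        {forest} : Multiset H
        isForest : IsForest H label forest
        joined   : ∀ e → e ∈ F → Joined H label e
        {bound}  : Carrier
        lower    : ∀ e → e ∉ F → bound ≤ ρ e
        abel     : M′ * weight forest ρ + N′ * fromℕ ∣ F ∣ * bound
                 ≤ N′ * weight (members F) ρ + M′ * fromℕ (size H forest) * bound

    -- With all hyperedges joined, `balanced⇒joined-≤` forces the forest to have N members, so it is
    -- a hypertree and has weight at least 1. The two terms with `bound` then agree and cancel.
    finish : ∀ {F} → State F → (∀ e → e ∈ F) → M′ ≤ N′ * sum ρ
    finish {F} state all∈F = +-cancelʳ-≤ (N′ * M′ * bound) (begin
      M′ + N′ * M′ * bound                            ≈⟨ +-congʳ (*-identityʳ M′) ⟨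
      M′ * 1# + N′ * M′ * bound
        ≤⟨ +-monoˡ-≤ _ (*-monoˡ-≤ (0≤fromℕ ∣E∣) (adm⇒1≤weight hypertree adm)) ⟩
      M′ * weight forest ρ + N′ * M′ * bound          ≈⟨ +-congˡ (*-congʳ (*-congˡ (fromℕ-cong ∣F∣≡∣E∣))) ⟨
      M′ * weight forest ρ + N′ * fromℕ ∣ F ∣ * bound ≤⟨ abel ⟩
      N′ * weight (members F) ρ + M′ * fromℕ (size H forest) * bound
        ≈⟨ +-cong (*-congˡ members≈) (*-congʳ (trans (*-congˡ (fromℕ-cong size≡N)) (*-comm M′ N′))) ⟩
      N′ * sum ρ + N′ * M′ * bound                    ∎)
      where
      open State state
      ∣F∣≡∣E∣ : ∣ F ∣ ≡ ∣E∣
      ∣F∣≡∣E∣ = ≡.trans (∣p∣≡∑ F) (≡.trans (ℕ∑.sum-cong-≗ λ e → indicator-yes (e ∈? F) (all∈F e))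
        (≡.trans (∑-constℕ ∣E∣ 1) (ℕ.*-identityʳ ∣E∣)))

      size≡N : size H forest ≡ N
      size≡N = ℕ.≤-antisym (forest⇒size-≤ H isForest)
        (ℕ.*-cancelˡ-≤ ∣E∣ {{ℕ.>-nonZero 1≤∣E∣}} (ℕ.≤-trans
          (ℕ.≤-reflexive (≡.trans (ℕ.*-comm ∣E∣ N) (≡.cong (N ℕ.*_) (≡.sym ∣F∣≡∣E∣))))
          (balanced⇒joined-≤ H balanced isForest F joined)))

      hypertree : IsSpanningHypertree H forest
      hypertree = hyperforest⇒spanning H 2≤∣V∣ (forest⇒hyperforest H isForest) size≡N

      members≈ : weight (members F) ρ ≈ sum ρ
      members≈ =
        sum-cong-≋ λ e → trans (*-congʳ (trans (fromℕ-cong (indicator-yes (e ∈? F) (all∈F e))) fromℕ-1)) (*-identityˡ _)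

    -- The threshold rises from b to ρ(e). This adds N ∣F∣ (ρ(e) - b) on the left of `abel` and ∣E∣
    -- ∣A∣ (ρ(e) - b) on the right, where ∣A∣ is the size of the old forest; `joined-≤` compares the
    -- two. At the new threshold the copies of `e` and its membership in `F` weigh equally on both
    -- sides.
    insert : ∀ {F} → State F → ∀ e → e ∉ F → (∀ e′ → e′ ∉ F → ρ e ≤ ρ e′) → State (F ∪ ⁅ e ⁆)
    insert {F} state e e∉F minimal = record
      { isForest = Extension.isForest ext
      ; joined   = joined′
      ; bound    = ρ e
      ; lower    = λ e′ e′∉ → minimal e′ (λ e′∈F → e′∉ (Subset.p⊆p∪q _ e′∈F))
      ; abel     = begin
          M′ * weight (Extension.forest ext) ρ + N′ * fromℕ ∣ F ∪ ⁅ e ⁆ ∣ * ρ e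
            ≈⟨ +-cong (*-congˡ weight′) (*-congʳ (*-congˡ
                 (trans (fromℕ-cong (∣F∪⁅e⁆∣ F e∉F)) (trans (fromℕ-+ ∣ F ∣ 1) (+-congˡ fromℕ-1))))) ⟩
          M′ * (weight forest ρ + fromℕ k * ρ e) + N′ * (fromℕ ∣ F ∣ + 1#) * ρ e
            ≈⟨ solve 7 (λ M N W k r f b → M :* (W :+ k :* r) :+ N :* (f :+ :1) :* r
                 := (M :* W :+ N :* f :* b) :+ (M :* k :* r :+ N :* r :+ N :* f :* (r :- b)))
                 refl M′ N′ (weight forest ρ) (fromℕ k) (ρ e) (fromℕ ∣ F ∣) bound ⟩
          (M′ * weight forest ρ + N′ * fromℕ ∣ F ∣ * bound)
            + (M′ * fromℕ k * ρ e + N′ * ρ e + N′ * fromℕ ∣ F ∣ * (ρ e - bound))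
            ≤⟨ +-mono-≤ abel (+-monoʳ-≤ _ (*-monoʳ-≤ (x≤y⇒0≤y-x (lower e e∉F)) joined-≤)) ⟩
          (N′ * weight (members F) ρ + M′ * fromℕ (size H forest) * bound)
            + (M′ * fromℕ k * ρ e + N′ * ρ e + M′ * fromℕ (size H forest) * (ρ e - bound))
            ≈⟨ solve 7 (λ M N W k r s b → (N :* W :+ M :* s :* b) :+ (M :* k :* r :+ N :* r :+ M :* s :* (r :- b))
                 := N :* (W :+ r) :+ M :* (s :+ k) :* r)
                 refl M′ N′ (weight (members F) ρ) (fromℕ k) (ρ e) (fromℕ (size H forest)) bound ⟩
          N′ * (weight (members F) ρ + ρ e) + M′ * (fromℕ (size H forest) + fromℕ k) * ρ e
            ≈⟨ +-cong (*-congˡ members′) (*-congʳ (*-congˡ (trans (fromℕ-cong size′) (fromℕ-+ (size H forest) k)))) ⟨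
          N′ * weight (members (F ∪ ⁅ e ⁆)) ρ + M′ * fromℕ (size H (Extension.forest ext)) * ρ e ∎
      }
      where
      open State state
      ext : Extension H label forest e (allFin ∣V∣) (proj₁ (edge-nonempty H e))
      ext = extend H label forest isForest e (allFin ∣V∣) (proj₂ (edge-nonempty H e))

      k : ℕ
      k = Extension.copies ext

      joined′ : ∀ e′ → e′ ∈ F ∪ ⁅ e ⁆ → Joined H (Extension.label ext) e′
      joined′ e′ e′∈ u∈ v∈ with Subset.x∈p∪q⁻ F _ e′∈
      ... | inj₁ e′∈F = Extension.coarser ext (joined e′ e′∈F u∈ v∈)
      ... | inj₂ e′∈⁅e⁆ with ≡.refl ← Subset.x∈⁅y⁆⇒x≡y e e′∈⁅e⁆ =
        ≡.trans (Extension.joined ext (∈-allFin _) u∈) (≡.sym (Extension.joined ext (∈-allFin _) v∈))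

      joined-≤ : N′ * fromℕ ∣ F ∣ ≤ M′ * fromℕ (size H forest)
      joined-≤ = ≤-trans (≤-reflexive (sym (fromℕ-* N ∣ F ∣)))
        (≤-trans (fromℕ-mono-≤ (balanced⇒joined-≤ H balanced isForest F joined)) (≤-reflexive (fromℕ-* ∣E∣ _)))

      weight′ : weight (Extension.forest ext) ρ ≈ weight forest ρ + fromℕ k * ρ e
      weight′ =
        trans (weight-cong ρ (Extension.adds ext)) (trans (weight-+ forest (λ e′ → k ℕ.* indicator (e Fin.≟ e′)) ρ)
        (+-congˡ (trans (weight-scale k (λ e′ → indicator (e Fin.≟ e′)) ρ) (*-congˡ (weight-single e ρ)))))

      members′ : weight (members (F ∪ ⁅ e ⁆)) ρ ≈ weight (members F) ρ + ρ e
      members′ =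
        trans (weight-cong ρ (members-insert F e∉F)) (trans (weight-+ (members F) _ ρ) (+-congˡ (weight-single e ρ)))

      size′ : size H (Extension.forest ext) ≡ size H forest ℕ.+ k
      size′ = ≡.trans (ℕ∑.sum-cong-≗ (Extension.adds ext)) (≡.trans (ℕ∑.∑-distrib-+ forest _)
        (≡.cong (size H forest ℕ.+_) (≡.trans (≡.sym (ℕ∑.*-distribˡ-sum k (λ e′ → indicator (e Fin.≟ e′))))
          (≡.trans (≡.cong (k ℕ.*_) (∑-indicator-≡1 e)) (ℕ.*-identityʳ k)))))

    go : ∀ F → Acc _⊃_ F → State F → M′ ≤ N′ * sum ρ
    go F (acc rec) state with Fin.any? (λ e → ¬? (e ∈? F))
    ... | no  none = finish state λ e → decidable-stable (e ∈? F) λ e∉F → none (e , e∉F)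
    ... | yes some = λ lt → argmin (_∉ F) ρ some λ (e , e∉F , minimal) →
      go (F ∪ ⁅ e ⁆) (rec (Subset.p⊆p∪q _ , e , Subset.q⊆p∪q F _ (Subset.x∈⁅x⁆ e) , e∉F))
         (insert state e e∉F minimal) lt

  -- Duality between the multi-tree family and its blocker.

  private
    ∣codes∣ : ℕ
    ∣codes∣ = ∣V∣ ℕ.^ ∣E∣

    decode : Fin ∣codes∣ → Multiset H
    decode i e = toℕ (finToFun i e)

    -- Stated through some `A` that agrees with the decoded multiset pointwise, since equal values
    -- do not make two functions propositionally equal.
    HypertreeCode : Fin ∣codes∣ → Set
    HypertreeCode i = ∃[ A ] IsSpanningHypertree H A × (∀ e → A e ≡ decode i e)

  -- The multiplicities add up to ∣V∣ - 1, so each is below ∣V∣ and serves as a digit in base ∣V∣.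
  -- This leaves only finitely many hypertree constraints.
  hypertree-code : ∀ {A} → IsSpanningHypertree H A → ∃[ i ] (∀ e → A e ≡ decode i e)
  hypertree-code {A} hypertree = funToFin digit , λ e →
      ≡.trans (≡.sym (Fin.toℕ-fromℕ< (A<∣V∣ e))) (≡.cong toℕ (≡.sym (Fin.finToFun-funToFin digit e)))
    where
    A<∣V∣ : ∀ e → A e ℕ.< ∣V∣
    A<∣V∣ e =
      ℕ.≤-trans (s≤s (ℕ.≤-trans (term≤∑ A e) (ℕ.≤-reflexive (IsSpanningHypertree.size≡∣V∣-1 hypertree))))
      (ℕ.≤-reflexive (1+[∣V∣∸1]≡∣V∣ H))
    digit : Fin ∣E∣ → Fin ∣V∣
    digit e = fromℕ< (A<∣V∣ e)

  -- A code that is no hypertree gets the vacuous constraint 0 ≤ 0, so that all codes index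
  -- constraints. The decision of which codes are hypertrees is supplied classically in
  -- `blocker-duality`.
  Adm-Ω-polyhedron : (∀ i → Dec (HypertreeCode i)) → IsPolyhedron (Adm (Ω H))
  Adm-Ω-polyhedron hypertree? = record
    { #constraints = ∣E∣ ℕ.+ ∣codes∣
    ; L          = λ j → L (splitAt ∣E∣ j)
    ; β          = λ j → β (splitAt ∣E∣ j)
    ; linear     = λ j → linear (splitAt ∣E∣ j)
    ; sound      = λ Cx j → sound Cx (splitAt ∣E∣ j)
    ; complete   = λ {x} h → complete λ s →
        ≡.subst (λ s → β s ≤ L s x) (Fin.splitAt-join ∣E∣ ∣codes∣ s) (h (join ∣E∣ ∣codes∣ s))
    ; coordinate = λ e → e ↑ˡ ∣codes∣ , λ x → reflexive (≡.cong (λ s → L s x) (Fin.splitAt-↑ˡ ∣E∣ e ∣codes∣))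
    }
    where
    Lᵈ : ∀ i → Dec (HypertreeCode i) → Vector Carrier ∣E∣ → Carrier
    Lᵈ i (yes _) = weight (decode i)
    Lᵈ i (no  _) = λ _ → 0#

    βᵈ : ∀ i → Dec (HypertreeCode i) → Carrier
    βᵈ i (yes _) = 1#
    βᵈ i (no  _) = 0#

    L : Fin ∣E∣ ⊎ Fin ∣codes∣ → Vector Carrier ∣E∣ → Carrier
    L (inj₁ e) x = x e
    L (inj₂ i)   = Lᵈ i (hypertree? i)

    β : Fin ∣E∣ ⊎ Fin ∣codes∣ → Carrier
    β (inj₁ e) = 0#
    β (inj₂ i) = βᵈ i (hypertree? i)

    linear : ∀ s → IsLinear (L s)
    linear (inj₁ e) = coordinate-linear e
    linear (inj₂ i) with hypertree? i
    ... | yes _ = pairing-linear (fromℕ ∘ decode i)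
    ... | no  _ = zero-linear

    sound : ∀ {x} → Adm (Ω H) x → ∀ s → β s ≤ L s x
    sound (nonneg , _) (inj₁ e) = nonneg e
    sound {x} adm (inj₂ i) with hypertree? i
    ... | yes (A , hypertree , A≗) = ≤-trans (adm⇒1≤weight hypertree adm) (≤-reflexive (weight-cong x A≗))
    ... | no  _ = ≤-reflexive refl

    complete : ∀ {x} → (∀ s → β s ≤ L s x) → Adm (Ω H) x
    complete {x} h =
      (λ e → h (inj₁ e)) , λ γ (A , hypertree , γ≈A) → hypertree-case γ A hypertree γ≈A (hypertree-code hypertree)
      where
      hypertree-case : ∀ γ A → IsSpanningHypertree H A → (∀ e → γ e ≈ fromℕ (A e)) →
        ∃[ i ] (∀ e → A e ≡ decode i e) →
        1# ≤ sum λ e → γ e * x e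
      hypertree-case γ A hypertree γ≈A (i , A≗) with hypertree? i | h (inj₂ i)
      ... | no none | _  = contradiction (A , hypertree , A≗) none
      ... | yes _   | le = ≤-trans le (≤-reflexive (sum-cong-≋ λ e →
        *-congʳ (trans (fromℕ-cong (≡.sym (A≗ e))) (sym (γ≈A e)))))

  pairing-comm : ∀ (ρ η : Vector Carrier ∣E∣) → sum (λ e → ρ e * η e) ≈ sum (λ e → η e * ρ e)
  pairing-comm ρ η = sum-cong-≋ λ e → *-comm (ρ e) (η e)

  -- Admissibility of `η` speaks only of extreme points; minimising the pairing with `η` over the
  -- polyhedron extends it to every `ρ`. That `η` is nonnegative makes this pairing monotone, as
  -- `minimum-at-extreme-point` requires.
  blocker-duality : ∀ {η ρ} → Adm (Blocker (Ω H)) η → Adm (Ω H) ρ → 1# ≤ sum λ e → ρ e * η e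
  blocker-duality {η} {ρ} (0≤η , adm) ρ-adm lt =
    ¬¬-∀Fin (λ i → ¬¬-excluded-middle {A = HypertreeCode i}) λ hypertree? →
    minimum-at-extreme-point (Adm-Ω-polyhedron hypertree?) (pairing-linear η)
      (λ x≤y → ∑-mono-≤ λ e → *-monoˡ-≤ (0≤η e) (x≤y e))
      (λ ξ extreme → ≤-trans (adm ξ extreme) (≤-reflexive (pairing-comm ξ η)))
      ρ ρ-adm (<-respˡ-≈ (pairing-comm ρ η) lt)

  -- Without hypertrees the zero density would be admissible for Ω, yet it pairs to 0 with `η`.
  hypertree-exists : ∀ {η} → Adm (Blocker (Ω H)) η → ¬ ¬ (∃[ A ] IsSpanningHypertree H A)
  hypertree-exists {η} adm none = blocker-duality {η} {λ _ → 0#} adm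
    ((λ _ → ≤-reflexive refl) , λ γ (A , hypertree , _) → contradiction (A , hypertree) none)
    (<-respˡ-≈ (sym (trans (sym (*-distribˡ-sum 0# η)) (zeroˡ _))) 0<1)

  -- Energy of constant densities, and balance from homogeneity.

  energy₂-segment : ∀ (η : Vector Carrier ∣E∣) {a} (A : Multiset H) s t → (∀ e → η e ≈ a) →
    energy₂ (λ e → s * η e + t * fromℕ (A e))
      ≈ s * s * (a * fromℕ ∣E∣ * a) + (s * t * (1# + 1#) * (a * fromℕ (size H A)) + t * t * energy₂ (fromℕ ∘ A))
  energy₂-segment η {a} A s t η≈a = begin
    sum (λ e → (s * η e + t * fromℕ (A e)) * (s * η e + t * fromℕ (A e)))
      ≈⟨ sum-cong-≋ (λ e → trans (*-cong (+-congʳ (*-congˡ (η≈a e))) (+-congʳ (*-congˡ (η≈a e))))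
           (solve 4 (λ s a t α → (s :* a :+ t :* α) :* (s :* a :+ t :* α)
              := s :* s :* (a :* a) :+ (α :* (s :* t :* (:1 :+ :1) :* a) :+ t :* t :* (α :* α)))
              refl s a t (fromℕ (A e)))) ⟩
    sum (λ e → s * s * (a * a) + (fromℕ (A e) * (s * t * (1# + 1#) * a) + t * t * (fromℕ (A e) * fromℕ (A e))))
      ≈⟨ ∑-distrib-+ {∣E∣} (λ _ → s * s * (a * a)) _ ⟩
    sum {∣E∣} (λ _ → s * s * (a * a))
      + sum (λ e → fromℕ (A e) * (s * t * (1# + 1#) * a) + t * t * (fromℕ (A e) * fromℕ (A e)))
      ≈⟨ +-cong (∑-const ∣E∣ _) (∑-distrib-+ (λ e → fromℕ (A e) * (s * t * (1# + 1#) * a)) _) ⟩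
    fromℕ ∣E∣ * (s * s * (a * a))
      + (weight A (λ _ → s * t * (1# + 1#) * a) + sum (λ e → t * t * (fromℕ (A e) * fromℕ (A e))))
      ≈⟨ +-cong (solve 3 (λ M s a → M :* (s :* s :* (a :* a)) := s :* s :* (a :* M :* a)) refl (fromℕ ∣E∣) s a)
           (+-cong (trans (weight-const A _) (solve 4 (λ α s t a → α :* (s :* t :* (:1 :+ :1) :* a)
               := s :* t :* (:1 :+ :1) :* (a :* α)) refl (fromℕ (size H A)) s t a))
             (sym (*-distribˡ-sum (t * t) (λ e → fromℕ (A e) * fromℕ (A e))))) ⟩
    s * s * (a * fromℕ ∣E∣ * a) + (s * t * (1# + 1#) * (a * fromℕ (size H A)) + t * t * energy₂ (fromℕ ∘ A)) ∎
    where open import Relation.Binary.Reasoning.Setoid setoid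

  square-nonneg : ∀ x → 0# ≤ x * x
  square-nonneg x xx<0 = ≤-total 0# x λ where
    (inj₁ 0≤x) → *-nonneg 0≤x 0≤x xx<0
    (inj₂ x≤0) → let 0≤-x = ≤-trans (x≤y⇒0≤y-x x≤0) (≤-reflexive (+-identityˡ (- x))) in
      *-nonneg 0≤-x 0≤-x (<-respˡ-≈ (solve 1 (λ x → x :* x := :- x :* :- x) refl x) xx<0)

  energy₂-const : ∀ (η : Vector Carrier ∣E∣) {a} → (∀ e → η e ≈ a) → energy₂ η ≈ a * fromℕ ∣E∣ * a
  energy₂-const η {a} η≈a = trans (sum-cong-≋ λ e → *-cong (η≈a e) (η≈a e)) (trans (∑-const ∣E∣ (a * a))
    (solve 2 (λ M a → M :* (a :* a) := a :* M :* a) refl (fromℕ ∣E∣) a))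

  -- Otherwise, moving from η towards the indicator of any hypertree decreases the energy.
  optimal-const⇒≤ : ∀ {η a} → IsOptimalDensity (Blocker (Ω H)) η → (∀ e → η e ≈ a) → a * fromℕ ∣E∣ ≤ fromℕ N
  optimal-const⇒≤ {η} {a} (adm , optimal) η≈a N<aM =
    hypertree-exists adm λ (A , hypertree) → contra A hypertree
    where
    M′ N′ : Carrier
    M′ = fromℕ ∣E∣
    N′ = fromℕ N

    0<aM : 0# < a * M′
    0<aM = ≤-<-trans (0≤fromℕ N) N<aM

    contra : ∀ A → IsSpanningHypertree H A → ⊥
    contra A hypertree = compare 0# a λ where
        (inj₂ (inj₂ a<0)) → *-monoʳ-≤ (0≤fromℕ ∣E∣) (<⇒≤ a<0) (<-respˡ-≈ (sym (zeroˡ M′)) 0<aM)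
        (inj₂ (inj₁ 0≈a)) → <-irrefl (sym (trans (*-congʳ (sym 0≈a)) (zeroˡ M′))) 0<aM
        (inj₁ 0<a) → decrease 0<a
      where
      q g : Carrier
      q = energy₂ (fromℕ ∘ A)
      -- Up to the factor -2, the derivative at t = 0 of the energy of `σ t`; it is positive exactly
      -- because a ∣E∣ > N is assumed.
      g = a * (a * M′ - N′)

      0≤q : 0# ≤ q
      0≤q = ∑-nonneg λ e → square-nonneg (fromℕ (A e))

      σ : Carrier → Vector Carrier ∣E∣
      σ t e = (1# - t) * η e + t * fromℕ (A e)

      -- The multiplicity vector of `A` is itself admissible for the blocker, whose members lie in
      -- `Adm` of Ω; the admissible densities form a convex set.
      σ-adm : ∀ {t} → 0# ≤ t → t ≤ 1# → Adm (Blocker (Ω H)) (σ t)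
      σ-adm {t} 0≤t t≤1 = nonneg , covers
        where
        open ≤-Reasoning
        nonneg : ∀ e → 0# ≤ σ t e
        nonneg e = ≤-trans (≤-reflexive (sym (+-identityˡ 0#)))
          (+-mono-≤ (*-nonneg (x≤y⇒0≤y-x t≤1) (proj₁ adm e)) (*-nonneg 0≤t (0≤fromℕ (A e))))
        covers : ∀ ξ → Blocker (Ω H) ξ → 1# ≤ sum λ e → ξ e * σ t e
        covers ξ ξ∈ = begin
          1#                                      ≈⟨ solve 1 (λ t → :1 := (:1 :- t) :* :1 :+ t :* :1) refl t ⟩
          (1# - t) * 1# + t * 1#                  ≤⟨ +-mono-≤ (*-monoˡ-≤ (x≤y⇒0≤y-x t≤1) (proj₂ adm ξ ξ∈))
              (*-monoˡ-≤ 0≤t (≤-trans (adm⇒1≤weight hypertree (proj₁ ξ∈)) (≤-reflexive (pairing-comm (fromℕ ∘ A) ξ)))) ⟩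
          (1# - t) * sum (λ e → ξ e * η e) + t * sum (λ e → ξ e * fromℕ (A e))
            ≈⟨ IsLinear.combination (pairing-linear ξ) (1# - t) t η (fromℕ ∘ A) ⟨
          sum (λ e → ξ e * σ t e)                 ∎

      decrease : 0# < a → ⊥
      -- The step is t = g / (g + q). It is at most 1 because q ≥ 0, and g - t q equals t g, so the
      -- linear gain outweighs the quadratic term.
      decrease 0<a = case ∃-inverse 0<g+q of λ (i , 0<i , i*[g+q]≈1) → step (g * i) (*-pos 0<g 0<i)
          (trans (*-assoc g i (g + q)) (trans (*-congˡ i*[g+q]≈1) (*-identityʳ g)))
        where
        open ≤-Reasoning
        0<g : 0# < g
        0<g = *-pos 0<a (x<y⇒0<y-x N<aM)

        0<g+q : 0# < g + q
        0<g+q = <-≤-trans 0<g (≤-trans (≤-reflexive (sym (+-identityʳ g))) (+-monoʳ-≤ g 0≤q))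

        step : ∀ t → 0# < t → t * (g + q) ≈ g → ⊥
        step t 0<t t*[g+q]≈g = optimal (σ t) (σ-adm (<⇒≤ 0<t) t≤1) (begin-strict
            energy₂ (σ t)
              ≈⟨ energy₂-segment η A (1# - t) t η≈a ⟩
            (1# - t) * (1# - t) * (a * M′ * a) + ((1# - t) * t * (1# + 1#) * (a * fromℕ (size H A)) + t * t * q)
              ≈⟨ +-congˡ (+-congʳ (*-congˡ (*-congˡ (fromℕ-cong (IsSpanningHypertree.size≡∣V∣-1 hypertree))))) ⟩
            (1# - t) * (1# - t) * (a * M′ * a) + ((1# - t) * t * (1# + 1#) * (a * N′) + t * t * q)
              ≈⟨ solve 5 (λ t a M N q → (:1 :- t) :* (:1 :- t) :* (a :* M :* a)
                   :+ ((:1 :- t) :* t :* (:1 :+ :1) :* (a :* N) :+ t :* t :* q)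
                   := a :* M :* a :- t :* ((:1 :- t) :* (a :* (a :* M :- N)) :+ (t :* (a :* N) :+ (a :* (a :* M :- N)
                       :- t :* q)))) refl t a M′ N′ q ⟩
            a * M′ * a - t * ((1# - t) * g + (t * (a * N′) + (g - t * q)))
              <⟨ subtract-pos (*-pos 0<t (<-≤-trans 0<g-tq (≤-trans
                   (≤-reflexive (sym (trans (+-identityˡ _) (+-identityˡ _))))
                   (+-mono-≤ (*-nonneg (x≤y⇒0≤y-x t≤1) (<⇒≤ 0<g))
                     (+-monoˡ-≤ _ (*-nonneg (<⇒≤ 0<t) (*-nonneg (<⇒≤ 0<a) (0≤fromℕ N)))))))) ⟩
            a * M′ * a
              ≈⟨ energy₂-const η η≈a ⟨
            energy₂ η ∎)
          where
          t≤1 : t ≤ 1#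
          t≤1 = *-cancelˡ-≤ 0<g+q (begin
            (g + q) * t   ≈⟨ *-comm _ t ⟩
            t * (g + q)   ≈⟨ t*[g+q]≈g ⟩
            g             ≈⟨ +-identityʳ g ⟨
            g + 0#        ≤⟨ +-monoʳ-≤ g 0≤q ⟩
            g + q         ≈⟨ *-identityʳ _ ⟨
            (g + q) * 1#  ∎)

          0<g-tq : 0# < g - t * q
          0<g-tq = <-respʳ-≈ (trans (solve 3 (λ t g q → t :* g := t :* (g :+ q) :- t :* q) refl t g q)
            (+-congʳ t*[g+q]≈g)) (*-pos 0<t 0<g)

          subtract-pos : ∀ {x y} → 0# < y → x - y < x
          subtract-pos {x} {y} 0<y = <-respˡ-≈ (+-identityˡ (x - y))
            (<-respʳ-≈ (solve 2 (λ x y → y :+ (x :- y) := x) refl x y) (+-monoˡ-< (x - y) 0<y))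

  -- The partition into X and singletons has `q` + 1 parts, and `D` hyperedges cross it. Pairing
  -- gives q ≤ a D, and `optimal-const⇒≤` gives a ∣E∣ ≤ N; together ∣E∣ q ≤ N D, which is the
  -- inequality for X once D is written as ∣E∣ - ∣E[X]∣.
  homogeneous⇒balanced : Homogeneous H → Balanced H
  homogeneous⇒balanced (η , opt@(adm , _) , a , η≈a) X ne with ∣ X ∣ ℕ.<? ∣V∣
  -- For X = V the partition has a single part and its density would divide by 0; here ∣E[X]∣ ≤ ∣E∣
  -- suffices.
  ... | no ∣X∣≮∣V∣ = begin
    N ℕ.* ∣ E[ H ] X ∣ ℕ.+ ∣E∣   ≤⟨ ℕ.+-monoˡ-≤ ∣E∣ (ℕ.*-monoʳ-≤ N (Subset.∣p∣≤n (E[ H ] X))) ⟩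
    N ℕ.* ∣E∣ ℕ.+ ∣E∣            ≡⟨ rearrange N ∣E∣ ⟩
    ∣E∣ ℕ.* (1 ℕ.+ N)            ≡⟨ ≡.cong (∣E∣ ℕ.*_) (1+[∣V∣∸1]≡∣V∣ H) ⟩
    ∣E∣ ℕ.* ∣V∣                  ≤⟨ ℕ.*-monoʳ-≤ ∣E∣ (ℕ.≮⇒≥ ∣X∣≮∣V∣) ⟩
    ∣E∣ ℕ.* ∣ X ∣                ∎
    where
    open ℕ.≤-Reasoning
    rearrange : ∀ N m → N ℕ.* m ℕ.+ m ≡ m ℕ.* (1 ℕ.+ N)
    rearrange = solve-∀
  ... | yes ∣X∣<∣V∣ = ℕ.+-cancelʳ-≤ (∣E∣ ℕ.* q) _ _ (begin
    N ℕ.* EX ℕ.+ ∣E∣ ℕ.+ ∣E∣ ℕ.* q     ≤⟨ ℕ.+-monoʳ-≤ (N ℕ.* EX ℕ.+ ∣E∣) ∣E∣*q≤N*D ⟩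
    N ℕ.* EX ℕ.+ ∣E∣ ℕ.+ N ℕ.* D       ≡⟨ rearrange N EX ∣E∣ D ⟩
    N ℕ.* (EX ℕ.+ D) ℕ.+ ∣E∣           ≡⟨ ≡.cong (λ k → N ℕ.* k ℕ.+ ∣E∣) EX+D≡∣E∣ ⟩
    N ℕ.* ∣E∣ ℕ.+ ∣E∣                  ≡⟨ rearrange′ N ∣E∣ ⟩
    ∣E∣ ℕ.* (1 ℕ.+ N)
      ≡⟨ ≡.cong (∣E∣ ℕ.*_) (≡.trans (1+[∣V∣∸1]≡∣V∣ H) (≡.sym (ℕ.m+[n∸m]≡n (ℕ.<⇒≤ ∣X∣<∣V∣)))) ⟩
    ∣E∣ ℕ.* (∣ X ∣ ℕ.+ q)              ≡⟨ ℕ.*-distribˡ-+ ∣E∣ ∣ X ∣ q ⟩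
    ∣E∣ ℕ.* ∣ X ∣ ℕ.+ ∣E∣ ℕ.* q        ∎)
    where
    open ℕ.≤-Reasoning
    rearrange : ∀ N x m d → N ℕ.* x ℕ.+ m ℕ.+ N ℕ.* d ≡ N ℕ.* (x ℕ.+ d) ℕ.+ m
    rearrange = solve-∀
    rearrange′ : ∀ N m → N ℕ.* m ℕ.+ m ≡ m ℕ.* (1 ℕ.+ N)
    rearrange′ = solve-∀

    q EX D : ℕ
    q  = ∣V∣ ℕ.∸ ∣ X ∣
    EX = ∣ E[ H ] X ∣
    D  = ℕ∑.sum λ e → indicator (¬? (edge e ⊆? X))

    outside : Multiset H
    outside e = indicator (¬? (edge e ⊆? X))

    0<q : 0 ℕ.< q
    0<q = ℕ.m<n⇒0<n∸m ∣X∣<∣V∣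

    indicator-¬ : ∀ {P : Set} (d : Dec P) → indicator d ℕ.+ indicator (¬? d) ≡ 1
    indicator-¬ (yes _) = ≡.refl
    indicator-¬ (no _)  = ≡.refl

    EX+D≡∣E∣ : EX ℕ.+ D ≡ ∣E∣
    EX+D≡∣E∣ =
      ≡.trans (≡.cong (ℕ._+ D) (∣E[X]∣≡∑ H X))
        (≡.trans (≡.sym (ℕ∑.∑-distrib-+ (λ e → indicator (edge e ⊆? X)) outside))
      (≡.trans (ℕ∑.sum-cong-≗ λ e → indicator-¬ (edge e ⊆? X)) (≡.trans (∑-constℕ ∣E∣ 1) (ℕ.*-identityʳ ∣E∣))))

    -- The density 1_{E \ E[X]} / (∣V∣ - ∣X∣) of the partition of V into X and singletons.
    ρ : Carrier → Vector Carrier ∣E∣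
    ρ i e = i * fromℕ (outside e)

    -- Of the ∣V∣ - 1 members of a hypertree at most ∣X∣ - 1 lie inside X, which leaves at least ∣V∣
    -- - ∣X∣ outside.
    q≤weight : ∀ {A} → IsSpanningHypertree H A → q ℕ.≤ ℕ∑.sum (λ e → A e ℕ.* outside e)
    q≤weight {A} hypertree = ℕ.+-cancelˡ-≤ ∣ X ∣ _ _ (begin
      ∣ X ∣ ℕ.+ q                                   ≡⟨ ℕ.m+[n∸m]≡n (ℕ.<⇒≤ ∣X∣<∣V∣) ⟩
      ∣V∣                                           ≡⟨ 1+[∣V∣∸1]≡∣V∣ H ⟨
      1 ℕ.+ N                                       ≡⟨ ≡.cong suc (IsSpanningHypertree.size≡∣V∣-1 hypertree) ⟨
      1 ℕ.+ size H A
        ≡⟨ ≡.cong suc (ℕ∑.sum-cong-≗ λ e → split (edge e ⊆? X) (A e)) ⟨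
      1 ℕ.+ ℕ∑.sum (λ e → inX e ℕ.+ A e ℕ.* outside e)
        ≡⟨ ≡.cong suc (ℕ∑.∑-distrib-+ inX (λ e → A e ℕ.* outside e)) ⟩
      1 ℕ.+ (sizeIn H A X ℕ.+ W)
        ≤⟨ s≤s (ℕ.+-monoˡ-≤ W (IsSpanningHypertree.hyperforest hypertree X ne)) ⟩
      1 ℕ.+ ((∣ X ∣ ℕ.∸ 1) ℕ.+ W)                   ≡⟨ ≡.cong (ℕ._+ W) (ℕ.m+[n∸m]≡n (Nonempty⇒1≤∣p∣ ne)) ⟩
      ∣ X ∣ ℕ.+ W                                   ∎)
      where
      inX : Vector ℕ ∣E∣
      inX e = if does (edge e ⊆? X) then A e else 0
      W : ℕ
      W = ℕ∑.sum (λ e → A e ℕ.* outside e)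
      split : ∀ {P : Set} (d : Dec P) x → (if does d then x else 0) ℕ.+ x ℕ.* indicator (¬? d) ≡ x
      split (yes _) x = ≡.trans (≡.cong (x ℕ.+_) (ℕ.*-zeroʳ x)) (ℕ.+-identityʳ x)
      split (no _)  x = ℕ.*-identityʳ x

    ρ-adm : ∀ {i} → 0# < i → i * fromℕ q ≈ 1# → Adm (Ω H) (ρ i)
    ρ-adm {i} 0<i i*q≈1 = (λ e → *-nonneg (<⇒≤ 0<i) (0≤fromℕ (outside e))) , λ γ (A , hypertree , γ≈A) →
      ≤-trans (≤-reflexive (sym i*q≈1)) (≤-trans (*-monoˡ-≤ (<⇒≤ 0<i) (fromℕ-mono-≤ (q≤weight hypertree)))
        (≤-reflexive (trans (*-congˡ (fromℕ-∑ (λ e → A e ℕ.* outside e)))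
          (trans (*-distribˡ-sum i (λ e → fromℕ (A e ℕ.* outside e)))
          (sum-cong-≋ λ e → trans (*-congˡ (fromℕ-* (A e) (outside e)))
            (trans (solve 3 (λ i α o → i :* (α :* o) := α :* (i :* o)) refl i (fromℕ (A e)) (fromℕ (outside e)))
              (*-congʳ (sym (γ≈A e)))))))))

    fromℕ-q≤ : fromℕ q ≤ a * fromℕ D
    fromℕ-q≤ = case ∃-inverse (fromℕ-mono-< 0<q) of λ (i , 0<i , i*q≈1) → R.begin
      fromℕ q                                     R.≈⟨ *-identityʳ _ ⟨
      fromℕ q * 1#
        R.≤⟨ *-monoˡ-≤ (0≤fromℕ q) (blocker-duality adm (ρ-adm 0<i i*q≈1)) ⟩
      fromℕ q * sum (λ e → ρ i e * η e)
        R.≈⟨ *-congˡ (trans (sum-cong-≋ λ e → trans (*-congˡ (η≈a e))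
          (solve 3 (λ i o a → i :* o :* a := o :* (i :* a)) refl i (fromℕ (outside e)) a))
          (weight-const outside (i * a))) ⟩
      fromℕ q * (fromℕ D * (i * a))
        R.≈⟨ solve 4 (λ q d i a → q :* (d :* (i :* a)) := i :* q :* (a :* d)) refl (fromℕ q) (fromℕ D) i a ⟩
      i * fromℕ q * (a * fromℕ D)                 R.≈⟨ trans (*-congʳ i*q≈1) (*-identityˡ _) ⟩
      a * fromℕ D                                 R.∎
      where module R = ≤-Reasoning

    ∣E∣*q≤N*D : ∣E∣ ℕ.* q ℕ.≤ N ℕ.* D
    ∣E∣*q≤N*D = fromℕ-cancel-≤ (R.begin
      fromℕ (∣E∣ ℕ.* q)                R.≈⟨ fromℕ-* ∣E∣ q ⟩
      fromℕ ∣E∣ * fromℕ q              R.≤⟨ *-monoˡ-≤ (0≤fromℕ ∣E∣) fromℕ-q≤ ⟩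
      fromℕ ∣E∣ * (a * fromℕ D)
        R.≈⟨ solve 3 (λ m a d → m :* (a :* d) := a :* m :* d) refl (fromℕ ∣E∣) a (fromℕ D) ⟩
      a * fromℕ ∣E∣ * fromℕ D          R.≤⟨ *-monoʳ-≤ (0≤fromℕ D) (optimal-const⇒≤ opt η≈a) ⟩
      fromℕ N * fromℕ D                R.≈⟨ fromℕ-* N D ⟨
      fromℕ (N ℕ.* D)                  R.∎)
      where module R = ≤-Reasoning

  -- Optimality of the constant density in the balanced case.

  connected⇒1≤∣E∣ : 2 ℕ.≤ ∣V∣ → Connected H → 1 ℕ.≤ ∣E∣
  connected⇒1≤∣E∣ 2≤∣V∣ connected =
    case connected ⁅ v ⁆ (v , Subset.x∈⁅x⁆ v)
      (Subset.⊆-max _ , w , Subset.∈⊤ , Subset.x≢y⇒x∉⁅y⁆ w≢v)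
      of λ (e , _) → inhabited e
    where
    v w : Fin ∣V∣
    v = fromℕ< (ℕ.<⇒≤ 2≤∣V∣)
    w = fromℕ< 2≤∣V∣
    w≢v : w ≢ v
    w≢v w≡v =
      case ≡.trans (≡.sym (Fin.toℕ-fromℕ< 2≤∣V∣)) (≡.trans (≡.cong toℕ w≡v) (Fin.toℕ-fromℕ< (ℕ.<⇒≤ 2≤∣V∣))) of λ ()
    inhabited : ∀ {n} → Fin n → 1 ℕ.≤ n
    inhabited {suc n} _ = s≤s z≤n

  -- Every hypertree has exactly N members, so the constant density 1 / N pairs to 1 with each and
  -- is admissible for Ω; duality pairs it with `σ`.
  adm⇒N≤sum : 2 ℕ.≤ ∣V∣ → ∀ {σ} → Adm (Blocker (Ω H)) σ → fromℕ N ≤ sum σ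
  adm⇒N≤sum 2≤∣V∣ {σ} adm = case ∃-inverse (fromℕ-mono-< (ℕ.m<n⇒0<n∸m 2≤∣V∣)) of λ (i , 0<i , i*N≈1) → begin
    fromℕ N                                 ≈⟨ *-identityʳ _ ⟨
    fromℕ N * 1#
      ≤⟨ *-monoˡ-≤ (0≤fromℕ N) (blocker-duality adm (const-adm 0<i i*N≈1)) ⟩
    fromℕ N * sum (λ e → i * σ e)           ≈⟨ *-congˡ (*-distribˡ-sum i σ) ⟨
    fromℕ N * (i * sum σ)
      ≈⟨ solve 3 (λ n i s → n :* (i :* s) := i :* n :* s) refl (fromℕ N) i (sum σ) ⟩
    i * fromℕ N * sum σ                     ≈⟨ trans (*-congʳ i*N≈1) (*-identityˡ _) ⟩
    sum σ                                   ∎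
    where
    open ≤-Reasoning
    const-adm : ∀ {i} → 0# < i → i * fromℕ N ≈ 1# → Adm (Ω H) (λ _ → i)
    const-adm {i} 0<i i*N≈1 = (λ _ → <⇒≤ 0<i) , λ γ (A , hypertree , γ≈A) → ≤-reflexive (sym
      (trans (sum-cong-≋ λ e → *-congʳ (γ≈A e)) (trans (weight-const A i)
        (trans (*-congʳ (fromℕ-cong (IsSpanningHypertree.size≡∣V∣-1 hypertree))) (trans (*-comm _ i) i*N≈1)))))

  balanced⇒homogeneous : 2 ℕ.≤ ∣V∣ → Connected H → Balanced H → Homogeneous H
  balanced⇒homogeneous 2≤∣V∣ connected balanced = (λ _ → a) , (adm , optimal) , a , λ _ → refl
    where
    open ≤-Reasoning
    1≤∣E∣ : 1 ℕ.≤ ∣E∣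
    1≤∣E∣ = connected⇒1≤∣E∣ 2≤∣V∣ connected

    inverse : ∃[ i ] 0# < i × i * fromℕ ∣E∣ ≈ 1#
    inverse = ∃-inverse (fromℕ-mono-< 1≤∣E∣)

    i a : Carrier
    i = proj₁ inverse
    a = fromℕ N * i

    0≤i : 0# ≤ i
    0≤i = <⇒≤ (proj₁ (proj₂ inverse))

    i*M≈1 : i * fromℕ ∣E∣ ≈ 1#
    i*M≈1 = proj₂ (proj₂ inverse)

    a*M≈N : a * fromℕ ∣E∣ ≈ fromℕ N
    a*M≈N = trans (*-assoc _ i _) (trans (*-congˡ i*M≈1) (*-identityʳ _))

    0≤a : 0# ≤ a
    0≤a = *-nonneg (0≤fromℕ N) 0≤i

    adm : Adm (Blocker (Ω H)) (λ _ → a)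
    adm = (λ _ → 0≤a) , λ ξ (ξ-adm , _) → begin
      1#                              ≈⟨ i*M≈1 ⟨
      i * fromℕ ∣E∣                   ≤⟨ *-monoˡ-≤ 0≤i (balanced⇒∣E∣≤ 2≤∣V∣ 1≤∣E∣ balanced ξ-adm) ⟩
      i * (fromℕ N * sum ξ)
        ≈⟨ solve 3 (λ i n s → i :* (n :* s) := n :* i :* s) refl i (fromℕ N) (sum ξ) ⟩
      a * sum ξ                       ≈⟨ trans (*-distribˡ-sum a ξ) (sum-cong-≋ λ e → *-comm a (ξ e)) ⟩
      sum (λ e → ξ e * a)             ∎

    optimal : ∀ σ → Adm (Blocker (Ω H)) σ → energy₂ {∣E∣} (λ _ → a) ≤ energy₂ σ
    -- Cauchy-Schwarz in tangent form: 2 a x ≤ x² + a² is summed over the coordinates of `σ`. The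
    -- constant density has energy N a, so total mass at least N turns the left side into at least
    -- twice that energy.
    optimal σ σ-adm = +-cancelʳ-≤ (energy₂ {∣E∣} λ _ → a) (begin
      energy₂ {∣E∣} (λ _ → a) + energy₂ {∣E∣} (λ _ → a)   ≈⟨ +-cong energy-a energy-a ⟩
      fromℕ N * a + fromℕ N * a
        ≈⟨ solve 2 (λ n a → n :* a :+ n :* a := (:1 :+ :1) :* a :* n) refl (fromℕ N) a ⟩
      (1# + 1#) * a * fromℕ N
        ≤⟨ *-monoˡ-≤ (*-nonneg 0≤2 0≤a) (adm⇒N≤sum 2≤∣V∣ σ-adm) ⟩
      (1# + 1#) * a * sum σ                               ≈⟨ *-distribˡ-sum ((1# + 1#) * a) σ ⟩
      sum (λ e → (1# + 1#) * a * σ e)                     ≤⟨ ∑-mono-≤ 2ax≤x²+a² ⟩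
      sum (λ e → σ e * σ e + a * a)                       ≈⟨ ∑-distrib-+ (λ e → σ e * σ e) (λ _ → a * a) ⟩
      energy₂ σ + energy₂ {∣E∣} (λ _ → a)                 ∎)
      where
      energy-a : energy₂ {∣E∣} (λ _ → a) ≈ fromℕ N * a
      energy-a = trans (energy₂-const (λ _ → a) λ _ → refl) (*-congʳ a*M≈N)
      0≤2 : 0# ≤ 1# + 1#
      0≤2 = ≤-trans (≤-reflexive (sym (+-identityˡ 0#))) (+-mono-≤ (<⇒≤ 0<1) (<⇒≤ 0<1))
      2ax≤x²+a² : ∀ e → (1# + 1#) * a * σ e ≤ σ e * σ e + a * a
      2ax≤x²+a² e = 0≤y-x⇒x≤y (≤-trans (square-nonneg (σ e - a))
        (≤-reflexive (solve 2 (λ x a → (x :- a) :* (x :- a) := x :* x :+ a :* a :- (:1 :+ :1) :* a :* x) refl (σ e) a)))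

open import Data.Nat.Base using (_≤_)

theorem1p13 : ∀ {c ℓ₁ ℓ₂} (ℝ : RealNumbers c ℓ₁ ℓ₂) (H : Hypergraph) →
    2 ≤ Hypergraph.∣V∣ H → Connected H →
    Modulus.Homogeneous ℝ H ⇔ (∃[ r ] IsStrength H r × IsFractionalArboricity H r)
theorem1p13 ℝ H 2≤∣V∣ connected = mk⇔
  (λ homogeneous → balanced⇒strength≡arboricity H 2≤∣V∣ (homogeneous⇒balanced homogeneous))
  (λ S≡D → balanced⇒homogeneous 2≤∣V∣ connected (strength≡arboricity⇒balanced H 2≤∣V∣ S≡D))
  where
  open Counting
  open HypertreeModulus ℝ H
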